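{- There is a constant $c>0$ such that for all sufficiently large $n$ there exist two labeled combinatorial 4-PPTs with $n$ vertices and the same fixed (labeled) triangular outer face whose flip distance is at least $c\, n\log n$. In particular, the flip graph of labeled combinatorial 4-PPTs has diameter $\Omega(n\log n)$.
   Context: An angle of a plane embedded graph is an incidence of a vertex with a face. A combinatorial pseudo-triangulation is a simple planar graph with a fixed combinatorial embedding (rotation system and designated outer face) together with tags "reflex"/"convex" on its angles such that (1) every interior face has exactly three convex-tagged angles, (2) all angles of the outer face are tagged reflex, (3) no vertex is incident to more than one reflex-tagged angle. It is pointed if every vertex is incident to exactly one reflex-tagged angle. A combinatorial 4-PPT is a combinatorial pointed pseudo-triangulation whose interior faces are all bounded by simple cycles of length 3 or 4. Flip: let $e$ be an edge of an interior triangular face $\Delta$ such that $e$ is not an edge of the outer face, and let $F$ be the other face containing $e$. Removing $e$ merges $\Delta$ and $F$ into a region $R$. A flip of $e$ replaces $e$ by an edge $e'$ inside $R$ between two vertices of $R$ such that $e'$ splits $R$ into a triangular face and a face of the same size as $F$, and the resulting graph (which must be simple) with a suitable tag assignment is again a combinatorial 4-PPT. In the labeled setting vertices carry distinct labels, the outer face with its labels is fixed, and the flip distance is the minimum number of flips transforming one labeled combinatorial 4-PPT into the other. -}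

module Defs where

open import Data.Nat using (ℕ; zero; suc; _+_; _*_; _<_; _≤_)
open import Data.Fin using (Fin; _≟_) renaming (zero to fzero; suc to fsuc)
open import Data.Bool using (Bool; true; false; _∧_; _∨_; not; if_then_else_)
open import Data.Product using (Σ; _×_; _,_; proj₁; proj₂)
open import Data.Sum using (_⊎_)
open import Relation.Nullary using (¬_; does)
open import Relation.Binary.PropositionalEquality using (_≡_; _≢_)

iter : {A : Set} → (A → A) → ℕ → A → A
iter f zero    x = x
iter f (suc k) x = f (iter f k x)

countBelow : ℕ → (ℕ → Bool) → ℕ
countBelow zero    p = 0
countBelow (suc k) p = countBelow k p + (if p k then 1 else 0)

sumFin : (n : ℕ) → (Fin n → ℕ) → ℕ
sumFin zero    f = 0
sumFin (suc n) f = f fzero + sumFin n (λ i → f (fsuc i))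

countFin : (n : ℕ) → (Fin n → Bool) → ℕ
countFin n p = sumFin n (λ i → if p i then 1 else 0)

eqb : {n : ℕ} → Fin n → Fin n → Bool
eqb x y = does (x ≟ y)

-- Embedded graphs on the labelled vertex set Fin n.
--  * adj u v : adjacency (simple graph)
--  * rot v u : the neighbour following u in the (counterclockwise) cyclic
--              order of the neighbours of v  (rotation system);
--              canonically rot v u = u for non-neighbours u.
--  * reflex v u : tag of the angle (corner) at v between the consecutive
--                 neighbours u and rot v u  (true = reflex, false = convex);
--                 canonically false for non-neighbours u.
-- A dart is an ordered pair (u , v) with adj u v; faces are the orbits of
-- the face permutation  (u , v) ↦ (v , rot v u).  The corner of the face
-- that is entered by dart (u , v) is the corner at v after u.

record PPT (n : ℕ) : Set where
  field
    adj    : Fin n → Fin n → Bool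
    rot    : Fin n → Fin n → Fin n
    reflex : Fin n → Fin n → Bool
open PPT public

Dart : ℕ → Set
Dart n = Fin n × Fin n

step : {n : ℕ} → (Fin n → Fin n → Fin n) → Dart n → Dart n
step r (u , v) = (v , r v u)

IsDart : {n : ℕ} → (Fin n → Fin n → Bool) → Dart n → Set
IsDart A (u , v) = A u v ≡ true

SameFace : {n : ℕ} → (Fin n → Fin n → Fin n) → Dart n → Dart n → Set
SameFace r d d' = Σ ℕ λ k → iter (step r) k d ≡ d'

FaceLen : {n : ℕ} → (Fin n → Fin n → Fin n) → Dart n → ℕ → Set
FaceLen r d k = (0 < k) × (iter (step r) k d ≡ d)
              × (∀ j → 0 < j → j < k → iter (step r) j d ≢ d)

SimpleCycleFace : {n : ℕ} → (Fin n → Fin n → Fin n) → Dart n → ℕ → Set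
SimpleCycleFace r d k = (iter (step r) k d ≡ d)
  × (∀ i j → i < j → j < k →
       proj₁ (iter (step r) i d) ≢ proj₁ (iter (step r) j d))

data Reach {n : ℕ} (A : Fin n → Fin n → Bool) : Fin n → Fin n → Set where
  here  : ∀ {u} → Reach A u u
  there : ∀ {u v w} → A u v ≡ true → Reach A v w → Reach A u w

SimpleGraph : {n : ℕ} → (Fin n → Fin n → Bool) → Set
SimpleGraph A = (∀ u → A u u ≡ false) × (∀ u v → A u v ≡ A v u)

RotationSystem : {n : ℕ} → (Fin n → Fin n → Bool) → (Fin n → Fin n → Fin n) → Set
RotationSystem A r =
    (∀ v u → A v u ≡ true → A v (r v u) ≡ true)
  × (∀ v u → A v u ≡ false → r v u ≡ u)
  × (∀ v u w → A v u ≡ true → A v w ≡ true → r v u ≡ r v w → u ≡ w)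
  × (∀ v u w → A v u ≡ true → A v w ≡ true → Σ ℕ λ k → iter (r v) k u ≡ w)

Connected : {n : ℕ} → (Fin n → Fin n → Bool) → Set
Connected A = ∀ u v → Reach A u v

HasFaceCount : {n : ℕ} → (Fin n → Fin n → Bool) → (Fin n → Fin n → Fin n) → ℕ → Set
HasFaceCount {n} A r f = Σ (Dart n → Fin f) λ lab →
    (∀ d d' → IsDart A d → IsDart A d' → (lab d ≡ lab d' → SameFace r d d')
                                       × (SameFace r d d' → lab d ≡ lab d'))
  × (∀ i → Σ (Dart n) λ d → IsDart A d × (lab d ≡ i))

numDarts : {n : ℕ} → (Fin n → Fin n → Bool) → ℕ
numDarts {n} A = sumFin n (λ u → countFin n (A u))

-- planar (genus 0) combinatorial embedding of a connected graph:
-- Euler's formula V - E + F = 2, i.e. 2V + 2F = 4 + #darts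
Planar : {n : ℕ} → (Fin n → Fin n → Bool) → (Fin n → Fin n → Fin n) → Set
Planar {n} A r = Connected A ×
  (Σ ℕ λ f → HasFaceCount A r f × (2 * n + 2 * f ≡ 4 + numDarts A))

-- Combinatorial 4-PPT whose outer face is the triangle a → b → c
-- (the outer face is the face of the dart (a , b)).

Is4PPT : {n : ℕ} → Fin n → Fin n → Fin n → PPT n → Set
Is4PPT {n} a b c T =
    SimpleGraph (adj T)
  × RotationSystem (adj T) (rot T)
  × Planar (adj T) (rot T)
  × (∀ v u → adj T v u ≡ false → reflex T v u ≡ false)
  × (a ≢ b) × (b ≢ c) × (a ≢ c) × (adj T a b ≡ true)
  × (step (rot T) (a , b) ≡ (b , c)) × (step (rot T) (b , c) ≡ (c , a))
  × (step (rot T) (c , a) ≡ (a , b))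
  × (∀ d → IsDart (adj T) d → ¬ SameFace (rot T) (a , b) d →
       Σ ℕ λ k → ((k ≡ 3) ⊎ (k ≡ 4)) × SimpleCycleFace (rot T) d k
         × (countBelow k (λ i → let e = iter (step (rot T)) i d
                                in not (reflex T (proj₂ e) (proj₁ e))) ≡ 3))
  × (∀ d → SameFace (rot T) (a , b) d → reflex T (proj₂ d) (proj₁ d) ≡ true)
  × (∀ v → Σ (Fin n) λ u → (adj T v u ≡ true) × (reflex T v u ≡ true)
         × (∀ w → adj T v w ≡ true → reflex T v w ≡ true → w ≡ u))

isEdge : {n : ℕ} → Fin n → Fin n → Fin n → Fin n → Bool
isEdge x y p q = (eqb x p ∧ eqb y q) ∨ (eqb x q ∧ eqb y p)

adjDel : {n : ℕ} → (Fin n → Fin n → Bool) → Fin n → Fin n → Fin n → Fin n → Bool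
adjDel A p q v z = A v z ∧ not (isEdge v z p q)

rotDel : {n : ℕ} → (Fin n → Fin n → Fin n) → Fin n → Fin n → Fin n → Fin n → Fin n
rotDel r p q v z =
  if eqb v p ∧ eqb z q then q
  else if eqb v q ∧ eqb z p then p
  else if eqb v p ∧ eqb (r p z) q then r p q
  else if eqb v q ∧ eqb (r q z) p then r q p
  else r v z

adjIns : {n : ℕ} → (Fin n → Fin n → Bool) → Fin n → Fin n → Fin n → Fin n → Bool
adjIns A x y v z = A v z ∨ isEdge v z x y

rotIns : {n : ℕ} → (Fin n → Fin n → Fin n) → Fin n → Fin n → Fin n → Fin n
       → Fin n → Fin n → Fin n
rotIns r x u y w v z =
  if eqb v x ∧ eqb z u then y
  else if eqb v x ∧ eqb z y then r x u
  else if eqb v y ∧ eqb z w then x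
  else if eqb v y ∧ eqb z x then r y w
  else r v z

-- T' is obtained from T by one flip (both are 4-PPTs with outer triangle a b c).
-- The flipped edge e = {p , q}; Δ is the (interior, triangular) face of the dart
-- (p , q), F is the face of the dart (q , p); R is the face of the reduced map
-- containing the dart following (p , q) in Δ.  The new edge e' = {x , y} is
-- inserted in corners of R at x (after u) and at y (after w).
Flip : {n : ℕ} → Fin n → Fin n → Fin n → PPT n → PPT n → Set
Flip {n} a b c T T' =
  Is4PPT a b c T × Is4PPT a b c T' ×
  Σ (Fin n) λ p → Σ (Fin n) λ q → Σ (Fin n) λ x → Σ (Fin n) λ y →
  Σ (Fin n) λ u → Σ (Fin n) λ w →
  let A⁻ = adjDel (adj T) p q
      r⁻ = rotDel (rot T) p q
      r' = rotIns r⁻ x u y w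
      d₀ = step (rot T) (p , q)
  in (adj T p q ≡ true)
   × FaceLen (rot T) (p , q) 3
   × ¬ SameFace (rot T) (a , b) (p , q)
   × ¬ SameFace (rot T) (a , b) (q , p)
   × (x ≢ y) × (isEdge x y p q ≡ false) × (A⁻ x y ≡ false)
   × (A⁻ u x ≡ true) × SameFace r⁻ d₀ (u , x)
   × (A⁻ w y ≡ true) × SameFace r⁻ d₀ (w , y)
   × (∀ v z → adj T' v z ≡ adjIns A⁻ x y v z)
   × (∀ v z → rot T' v z ≡ r' v z)
   × (Σ ℕ λ m → FaceLen (rot T) (q , p) m
        × ((FaceLen r' (x , y) 3 × FaceLen r' (y , x) m)
           ⊎ (FaceLen r' (y , x) 3 × FaceLen r' (x , y) m)))

SamePPT : {n : ℕ} → PPT n → PPT n → Set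
SamePPT T T' = ∀ v z → (adj T v z ≡ adj T' v z) × (rot T v z ≡ rot T' v z)
                     × (reflex T v z ≡ reflex T' v z)

data FlipPath {n : ℕ} (a b c : Fin n) : PPT n → PPT n → ℕ → Set where
  done : ∀ {T T'} → SamePPT T T' → FlipPath a b c T T' 0
  next : ∀ {T T' T'' k} → Flip a b c T T' → FlipPath a b c T' T'' k
       → FlipPath a b c T T'' (suc k)

{-# OPTIONS --safe #-}

-- Counting, with the short encodings of Sleator, Tarjan and Thurston.  A flip
-- rewrites a bounded number of darts, and flips at disjoint sets of darts
-- commute.  Label every dart by the way in which the next flip touching it does
-- so.  A flip is enabled when the labels of all the darts it would touch name it;
-- any enabled flip can be executed first, so the final embedding is recovered by
-- executing enabled flips in an arbitrary order, given only the initial labels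
-- and the labels that each flip writes.  Hence at most 2^O(n + k) embeddings are
-- reachable by k flips from a given one.  On the other hand, the common
-- neighbours of the edge ab in the graph K_{2,n-2} + ab can be ordered in
-- (n - 3)! ways around a once c is fixed, and all of these are 4-PPTs.

module Submission where

open import Defs
open import Data.Nat using (ℕ; zero; suc; _+_; _*_; _∸_; _^_; _!; _/_; _≤_; _<_; z≤n; s≤s; _≤?_; ⌊_/2⌋; ⌈_/2⌉; >-nonZero)
open import Data.Nat.Properties using (≤-refl; ≤-trans; ≤-reflexive; <⇒≤; <⇒≱; ≰⇒>; m≤n⇒m≤1+n; m≤m+n; m≤n+m; m+[n∸m]≡n; +-suc; +-identityʳ; +-mono-≤; +-monoˡ-≤; +-monoʳ-≤; +-cancelˡ-≤; *-comm; *-identityʳ; *-zeroʳ; *-mono-≤; *-monoʳ-≤; *-monoˡ-<; *-cancelˡ-≤; *-cancelˡ-<; m^n>0; ^-monoˡ-≤; ^-monoʳ-≤; ^-monoʳ-<; ^-distribˡ-+-*; ^-*-assoc; 1≤n!; ⌊n/2⌋≤⌈n/2⌉; ⌊n/2⌋+⌈n/2⌉≡n; module ≤-Reasoning)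
open import Data.Nat.DivMod using (m/n*n≤m; m*n/n≡m; /-monoˡ-≤)
open import Data.Nat.Logarithm using (⌊log₂_⌋; ⌊log₂⌋-mono-≤; ⌊log₂[2^n]⌋≡n; ⌊log₂⌊n/2⌋⌋≡⌊log₂n⌋∸1)
open import Data.Nat.Tactic.RingSolver using (solve-∀)
open import Data.Bool using (Bool; true; false; _∧_; _∨_; not; if_then_else_)
open import Data.Fin using (Fin; zero; suc; _≟_; inject₁; fromℕ; punchIn; splitAt; join; combine; remQuot; finToFun; funToFin)
open import Data.Fin.Patterns
open import Data.Fin.Properties using (any?; all?; ¬∀⟶∃¬; pigeonhole; suc-injective; punchIn-injective; splitAt-join; join-splitAt; combine-injective; combine-remQuot; remQuot-combine; finToFun-funToFin) renaming (<⇒≢ to <⇒≢ᶠ)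
open import Data.Fin.Induction using (<-weakInduction; >-weakInduction)
open import Data.Fin.Relation.Unary.Top using (view; ‵fromℕ; ‵inject₁; view-fromℕ; view-inject₁)
open import Data.Fin.Permutation using (Permutation′; _⟨$⟩ʳ_; _⟨$⟩ˡ_; inverseˡ; inverseʳ; lift₀; insert; insert-punchIn) renaming (id to idₚ)
open import Data.Vec using (Vec; []; _∷_; lookup)
open import Data.Product using (Σ; ∃; ∃₂; _×_; _,_; proj₁; proj₂; swap; uncurry)
open import Data.Product.Properties using (≡-dec)
open import Data.Sum using (_⊎_; inj₁; inj₂; [_,_]′) renaming (map to map-⊎)
open import Data.Empty using (⊥-elim)
open import Relation.Nullary using (¬_; Dec; yes; no)
open import Relation.Nullary.Decidable using (_×-dec_; _→-dec_; map′)
open import Relation.Binary.PropositionalEquality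
open import Function using (_∘_)

-- A code with O(1) bits per flip can afford neither a vertex name nor an edge name, since each
-- costs about log n bits. Hence every reference is relative. Darts live in permanent slots; the
-- inserted edge takes over the two slots of the removed one, so the reversal of slots is the same
-- throughout a path. A rule speaks only of positions among the touched slots, and new end vertices
-- are copied from the tails of touched darts. A label likewise points to the flipped edge by a
-- short walk: a few face successors, then possibly one reversal. Faces of size at most 4 keep all
-- this finite: a flip affects at most 3 + 4 = 7 darts, and seven kinds of walk suffice to return
-- from any of them.
--
-- Labels refer to the future, so for a given path they are constructed from its end backwards,
-- while decoding runs forwards.

private variable
  M K n : ℕ
  X : Set

-- Overwriting a function at the entries of a vector.

hits? : (t : Vec (Fin M) K) (s : Fin M) → Dec (∃ λ k → lookup t k ≡ s)
hits? t s = any? (λ k → lookup t k ≟ s)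

pick : {P : Fin K → Set} → Dec (∃ P) → (Fin K → X) → X → X
pick (yes (k , _)) g a = g k
pick (no _)        g a = a

module _ {M K : ℕ} (t : Vec (Fin M) K) where

  opaque
    update : (Fin M → X) → (Fin K → X) → Fin M → X
    update f g s = pick (hits? t s) g (f s)

    update-out : (f : Fin M → X) (g : Fin K → X) {s : Fin M} →
                 (∀ k → lookup t k ≢ s) → update f g s ≡ f s
    update-out f g {s} miss with hits? t s
    ... | yes (k , eq) = ⊥-elim (miss k eq)
    ... | no _         = refl

    -- Entries of `t` may repeat, so the value stored at entry `k` can come from another position
    -- `j` holding the same slot. This `j` is chosen from `t` alone, hence serves all `f` and `g`.
    update-in : ∀ k → ∃ λ j → lookup t j ≡ lookup t k ×
                ((f : Fin M → X) (g : Fin K → X) → update f g (lookup t k) ≡ g j)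
    update-in k with hits? t (lookup t k)
    ... | yes (j , eq) = j , eq , λ _ _ → refl
    ... | no miss      = ⊥-elim (miss (k , refl))

    update-cong : {f f′ : Fin M → X} {g g′ : Fin K → X} →
                  f ≗ f′ → g ≗ g′ → update f g ≗ update f′ g′
    update-cong f≗ g≗ s with hits? t s
    ... | yes (k , _) = g≗ k
    ... | no _        = f≗ s

    update-unique : {f f′ : Fin M → X} {g : Fin K → X} →
                    (∀ k → f′ (lookup t k) ≡ g k) →
                    (∀ s → (∀ k → lookup t k ≢ s) → f′ s ≡ f s) →
                    f′ ≗ update f g
    update-unique on off s with hits? t s
    ... | yes (k , refl) = on k
    ... | no miss        = off s (λ k eq → miss (k , eq))

opaque
  unfolding update

  update-comm : (t t′ : Vec (Fin M) K) (f : Fin M → X) (g g′ : Fin K → X) →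
                (∀ j k → lookup t j ≢ lookup t′ k) →
                update t′ (update t f g) g′ ≗ update t (update t′ f g′) g
  update-comm t t′ f g g′ disj s with hits? t s | hits? t′ s
  ... | yes (j , p) | yes (k , q) = ⊥-elim (disj j k (trans p (sym q)))
  ... | yes _       | no _        = refl
  ... | no _        | yes _       = refl
  ... | no _        | no _        = refl

-- The face of a slot lists the darts of an embedding up to renaming: a slot
-- carries the slot of the next dart of its face and its two end vertices.
State : ℕ → ℕ → Set
State M n = Fin M → Fin M × Dart n

succ : State M n → Fin M → Fin M
succ σ s = proj₁ (σ s)

ends : State M n → Fin M → Dart n
ends σ s = proj₂ (σ s)

-- A rule says, for each of the seven touched slots, which touched slot becomes
-- its successor, and which touched slots have its new end vertices as tails.
opaque
  #rules : ℕ
  #rules = 7 ^ (7 * 3)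

  entry : Fin #rules → Fin 7 → Fin 3 → Fin 7
  entry τ k i = finToFun τ (combine k i)

  rule : (Fin 7 → Fin 3 → Fin 7) → Fin #rules
  rule f = funToFin (uncurry f ∘ remQuot 3)

  entry-rule : ∀ f k i → entry (rule f) k i ≡ f k i
  entry-rule f k i = trans (finToFun-funToFin (uncurry f ∘ remQuot 3) (combine k i))
                           (cong (uncurry f) (remQuot-combine k i))

Rule : Set
Rule = Fin #rules

-- The label of a slot is idle if no later flip touches it; otherwise it names
-- the rule of the next flip touching it, and how to reach the flipped edge.
opaque
  #labels : ℕ
  #labels = suc (7 * #rules)

  idle : Fin #labels
  idle = zero

  label : Fin 7 → Rule → Fin #labels
  label c τ = suc (combine c τ)

  label≢idle : ∀ c τ → label c τ ≢ idle
  label≢idle c τ ()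

  label-injective : ∀ {c τ c′ τ′} → label c τ ≡ label c′ τ′ → c ≡ c′ × τ ≡ τ′
  label-injective eq = combine-injective _ _ _ _ (suc-injective eq)

Label : Set
Label = Fin #labels

opaque
  #relabellings : ℕ
  #relabellings = #labels ^ 7

  newLabel : Fin #relabellings → Fin 7 → Label
  newLabel = finToFun

  relabelling : (Fin 7 → Label) → Fin #relabellings
  relabelling = funToFin

  newLabel-relabelling : ∀ f → newLabel (relabelling f) ≗ f
  newLabel-relabelling = finToFun-funToFin

Relabelling : Set
Relabelling = Fin #relabellings

-- Rules acting on states, their commutation, and the decoder.

module Machine {M n : ℕ} (tw : Fin M → Fin M) where

  -- The slots of the faces of e and of its twin; if the latter is a triangle,
  -- then the last entry is again tw e.  From each of them a jump leads back to e.
  opaque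
    touched : State M n → Fin M → Vec (Fin M) 7
    touched σ e =
      e ∷ φ e ∷ φ (φ e) ∷ tw e ∷ φ (tw e) ∷ φ (φ (tw e)) ∷ φ (φ (φ (tw e))) ∷ []
      where
      φ : Fin M → Fin M
      φ = succ σ

    jumps : State M n → Fin M → Vec (Fin M) 7
    jumps σ s =
      s ∷ φ s ∷ φ (φ s) ∷ tw s ∷ tw (φ s) ∷ tw (φ (φ s)) ∷ tw (φ (φ (φ s))) ∷ []
      where
      φ : Fin M → Fin M
      φ = succ σ

    newCell : State M n → Vec (Fin M) 7 → Rule → Fin 7 → Fin M × Dart n
    newCell σ t τ k =
      lookup t (entry τ k 0F) , tail (entry τ k 1F) , tail (entry τ k 2F)
      where
      tail : Fin 7 → Fin n
      tail j = proj₁ (ends σ (lookup t j))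

  Agree : {B : Set} → Vec (Fin M) 7 → (f g : Fin M → B) → Set
  Agree t f g = ∀ k → f (lookup t k) ≡ g (lookup t k)

  opaque
    unfolding touched jumps newCell

    -- Computing the list follows successors only from entries that are themselves in the list, and
    -- `tw` does not depend on the state.
    touched-local : ∀ σ σ′ e → Agree (touched σ e) σ′ σ → touched σ′ e ≡ touched σ e
    touched-local σ σ′ e agree
      rewrite agree 0F | agree 1F | agree 3F | agree 4F | agree 5F = refl

    newCell-local : ∀ σ σ′ t τ → Agree t σ′ σ → newCell σ′ t τ ≗ newCell σ t τ
    newCell-local σ σ′ t τ agree k =
      cong₂ (λ a b → lookup t (entry τ k 0F) , proj₁ (proj₂ a) , proj₁ (proj₂ b))
            (agree (entry τ k 1F)) (agree (entry τ k 2F))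

    jumps-local : ∀ σ σ′ s → σ′ s ≡ σ s → σ′ (succ σ s) ≡ σ (succ σ s) →
                  σ′ (succ σ (succ σ s)) ≡ σ (succ σ (succ σ s)) → jumps σ′ s ≡ jumps σ s
    jumps-local σ σ′ s p q r rewrite p | q | r = refl

  opaque
    apply : State M n → Fin M → Rule → State M n
    apply σ e τ = update (touched σ e) σ (newCell σ (touched σ e) τ)

    apply-at : ∀ σ e {t} τ → touched σ e ≡ t → apply σ e τ ≗ update t σ (newCell σ t τ)
    apply-at σ e τ refl s = refl

  Labelling : Set
  Labelling = Fin M → Label

  opaque
    relabel : State M n → Labelling → Fin M → Relabelling → Labelling
    relabel σ ℓ e w = update (touched σ e) ℓ (newLabel w)

    relabel-at : ∀ σ ℓ e {t} w → touched σ e ≡ t → relabel σ ℓ e w ≗ update t ℓ (newLabel w)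
    relabel-at σ ℓ e w refl s = refl

  -- The condition `closed` keeps the successor walks of `jumps` inside the touched slots, so that
  -- being enabled depends only on the state and the labels at these slots.
  record Enabled (σ : State M n) (ℓ : Labelling) (e : Fin M) (τ : Rule) : Set where
    private
      t : Fin 7 → Fin M
      t = lookup (touched σ e)
    field
      labelled : ∀ k → ∃ λ c → ℓ (t k) ≡ label c τ × lookup (jumps σ (t k)) c ≡ e
      closed   : ∀ k → ∃ λ j → succ σ (t k) ≡ t j
  open Enabled

  enabled? : ∀ σ ℓ e τ → Dec (Enabled σ ℓ e τ)
  enabled? σ ℓ e τ =
    map′ (λ (p , q) → record { labelled = p ; closed = q })
         (λ en → labelled en , closed en)
      (all? (λ k → any? (λ c → (ℓ (t k) ≟ label c τ) ×-dec (lookup (jumps σ (t k)) c ≟ e)))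
       ×-dec all? (λ k → any? (λ j → succ σ (t k) ≟ t j)))
    where t = lookup (touched σ e)

  enabled-local : ∀ {σ σ′ ℓ ℓ′ e τ} → Agree (touched σ e) σ′ σ →
                  Agree (touched σ e) ℓ′ ℓ → Enabled σ ℓ e τ → Enabled σ′ ℓ′ e τ
  enabled-local {σ} {σ′} {ℓ} {ℓ′} {e} {τ} agree agreeℓ en = record
    { labelled = λ k → subst (λ t → Labelled (lookup t k)) (sym same)
        (let c , p , q = labelled en k
         in c , trans (agreeℓ k) p , trans (cong (λ v → lookup v c) (jumps-same k)) q)
    ; closed = λ k → subst (λ t → ∃ λ j → succ σ′ (lookup t k) ≡ lookup t j) (sym same)
        (let j , p = closed en k in j , trans (cong proj₁ (agree k)) p)
    }
    where
    t : Fin 7 → Fin M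
    t = lookup (touched σ e)
    Labelled : Fin M → Set
    Labelled s = ∃ λ c → ℓ′ s ≡ label c τ × lookup (jumps σ′ s) c ≡ e
    same : touched σ′ e ≡ touched σ e
    same = touched-local σ σ′ e agree
    onNext : ∀ s → (∃ λ i → s ≡ t i) → σ′ s ≡ σ s
    onNext _ (i , refl) = agree i
    jumps-same : ∀ k → jumps σ′ (t k) ≡ jumps σ (t k)
    jumps-same k =
      let j , p = closed en k
          i , q = closed en j
      in jumps-local σ σ′ (t k) (agree k) (onNext _ (j , p))
                     (onNext _ (i , trans (cong (succ σ) p) q))

  -- The jump recorded in the label of a common slot leads to both flipped edges.
  enabled-disjoint : ∀ {σ ℓ e e′ τ τ′} → Enabled σ ℓ e τ → Enabled σ ℓ e′ τ′ → e ≢ e′ →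
                     ∀ j k → lookup (touched σ e) j ≢ lookup (touched σ e′) k
  enabled-disjoint {σ} {ℓ} en en′ e≢e′ j k eq
    with labelled en j | labelled en′ k
  ... | c , p , q | c′ , p′ , q′
    with label-injective (trans (sym p) (trans (cong ℓ eq) p′))
  ... | refl , _ =
    e≢e′ (trans (sym q) (trans (cong (λ s → lookup (jumps σ s) c) eq) q′))

  enabled-rule : ∀ {σ ℓ e τ τ′} → Enabled σ ℓ e τ → Enabled σ ℓ e τ′ → τ ≡ τ′
  enabled-rule en en′ with labelled en 0F | labelled en′ 0F
  ... | _ , p , _ | _ , p′ , _ = proj₂ (label-injective (trans (sym p) p′))

  apply-outside : ∀ σ e τ t → (∀ j k → lookup (touched σ e) j ≢ lookup t k) →
                  Agree t (apply σ e τ) σ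
  apply-outside σ e τ t disj k =
    trans (apply-at σ e τ refl (lookup t k)) (update-out (touched σ e) _ _ (λ j → disj j k))

  relabel-outside : ∀ σ ℓ e w t → (∀ j k → lookup (touched σ e) j ≢ lookup t k) →
                    Agree t (relabel σ ℓ e w) ℓ
  relabel-outside σ ℓ e w t disj k =
    trans (relabel-at σ ℓ e w refl (lookup t k)) (update-out (touched σ e) _ _ (λ j → disj j k))

  apply-cong : ∀ {σ σ′} e τ → σ′ ≗ σ → apply σ′ e τ ≗ apply σ e τ
  apply-cong {σ} {σ′} e τ σ≗ s = begin
    apply σ′ e τ s
      ≡⟨ apply-at σ′ e τ (touched-local σ σ′ e agree) s ⟩
    update t σ′ (newCell σ′ t τ) s
      ≡⟨ update-cong t σ≗ (newCell-local σ σ′ t τ agree) s ⟩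
    update t σ (newCell σ t τ) s
      ≡⟨ apply-at σ e τ refl s ⟨
    apply σ e τ s ∎
    where
    open ≡-Reasoning
    t : Vec (Fin M) 7
    t = touched σ e
    agree : Agree t σ′ σ
    agree k = σ≗ (lookup t k)

  relabel-cong : ∀ {σ σ′ ℓ ℓ′} e w → σ′ ≗ σ → ℓ′ ≗ ℓ → relabel σ′ ℓ′ e w ≗ relabel σ ℓ e w
  relabel-cong {σ} {σ′} {ℓ} {ℓ′} e w σ≗ ℓ≗ s = begin
    relabel σ′ ℓ′ e w s
      ≡⟨ relabel-at σ′ ℓ′ e w (touched-local σ σ′ e (λ k → σ≗ (lookup t k))) s ⟩
    update t ℓ′ (newLabel w) s
      ≡⟨ update-cong t ℓ≗ (λ _ → refl) s ⟩
    update t ℓ (newLabel w) s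
      ≡⟨ relabel-at σ ℓ e w refl s ⟨
    relabel σ ℓ e w s ∎
    where
    open ≡-Reasoning
    t : Vec (Fin M) 7
    t = touched σ e

  module _ (σ : State M n) (e e′ : Fin M) (τ τ′ : Rule)
           (disj : ∀ j k → lookup (touched σ e) j ≢ lookup (touched σ e′) k) where

    private
      t t′ : Vec (Fin M) 7
      t = touched σ e
      t′ = touched σ e′
      σ₁ σ₂ : State M n
      σ₁ = apply σ e τ
      σ₂ = apply σ e′ τ′
      agree′ : Agree t′ σ₁ σ
      agree′ = apply-outside σ e τ t′ disj
      agree : Agree t σ₂ σ
      agree = apply-outside σ e′ τ′ t (λ j k → ≢-sym (disj k j))
      same′ : touched σ₁ e′ ≡ t′
      same′ = touched-local σ σ₁ e′ agree′
      same : touched σ₂ e ≡ t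
      same = touched-local σ σ₂ e agree

    -- Each flip leaves the touched list and the new cells of the other as they were in `σ`. Both
    -- orders thus amount to the same two updates of `σ` at disjoint sets of slots.
    apply-comm : apply σ₁ e′ τ′ ≗ apply σ₂ e τ
    apply-comm s = begin
      apply σ₁ e′ τ′ s
        ≡⟨ apply-at σ₁ e′ τ′ same′ s ⟩
      update t′ σ₁ (newCell σ₁ t′ τ′) s
        ≡⟨ update-cong t′ (apply-at σ e τ refl) (newCell-local σ σ₁ t′ τ′ agree′) s ⟩
      update t′ (update t σ (newCell σ t τ)) (newCell σ t′ τ′) s
        ≡⟨ update-comm t t′ σ (newCell σ t τ) (newCell σ t′ τ′) disj s ⟩
      update t (update t′ σ (newCell σ t′ τ′)) (newCell σ t τ) s
        ≡⟨ update-cong t (apply-at σ e′ τ′ refl) (newCell-local σ σ₂ t τ agree) s ⟨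
      update t σ₂ (newCell σ₂ t τ) s
        ≡⟨ apply-at σ₂ e τ same s ⟨
      apply σ₂ e τ s ∎
      where open ≡-Reasoning

    relabel-comm : ∀ ℓ w w′ → relabel σ₁ (relabel σ ℓ e w) e′ w′ ≗
                              relabel σ₂ (relabel σ ℓ e′ w′) e w
    relabel-comm ℓ w w′ s = begin
      relabel σ₁ (relabel σ ℓ e w) e′ w′ s
        ≡⟨ relabel-at σ₁ (relabel σ ℓ e w) e′ w′ same′ s ⟩
      update t′ (relabel σ ℓ e w) (newLabel w′) s
        ≡⟨ update-cong t′ (relabel-at σ ℓ e w refl) (λ _ → refl) s ⟩
      update t′ (update t ℓ (newLabel w)) (newLabel w′) s
        ≡⟨ update-comm t t′ ℓ (newLabel w) (newLabel w′) disj s ⟩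
      update t (update t′ ℓ (newLabel w′)) (newLabel w) s
        ≡⟨ update-cong t (relabel-at σ ℓ e′ w′ refl) (λ _ → refl) s ⟨
      update t (relabel σ ℓ e′ w′) (newLabel w) s
        ≡⟨ relabel-at σ₂ (relabel σ ℓ e′ w′) e w same s ⟨
      relabel σ₂ (relabel σ ℓ e′ w′) e w s ∎
      where open ≡-Reasoning

  -- At the end all labels are idle, so no flip is enabled there: a decoder that fires whatever is
  -- enabled cannot run past the end.
  data Run (σ∞ : State M n) : State M n → Labelling → ℕ → Set where
    halt : ∀ {σ ℓ} → (∀ s → ℓ s ≡ idle) → σ ≗ σ∞ → Run σ∞ σ ℓ 0
    fire : ∀ {σ ℓ σ₁ ℓ₁ k e τ} (w : Relabelling) → Enabled σ ℓ e τ →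
           σ₁ ≗ apply σ e τ → ℓ₁ ≗ relabel σ ℓ e w → Run σ∞ σ₁ ℓ₁ k →
           Run σ∞ σ ℓ (suc k)

  run-cong : ∀ {σ∞ σ σ′ ℓ ℓ′ k} → σ′ ≗ σ → ℓ′ ≗ ℓ → Run σ∞ σ ℓ k → Run σ∞ σ′ ℓ′ k
  run-cong σ≗ ℓ≗ (halt quiet fin) =
    halt (λ s → trans (ℓ≗ s) (quiet s)) (λ s → trans (σ≗ s) (fin s))
  run-cong σ≗ ℓ≗ (fire {e = e} {τ} w en σ₁≗ ℓ₁≗ run) =
    fire w (enabled-local (λ _ → σ≗ _) (λ _ → ℓ≗ _) en)
      (λ s → trans (σ₁≗ s) (sym (apply-cong e τ σ≗ s)))
      (λ s → trans (ℓ₁≗ s) (sym (relabel-cong e w σ≗ ℓ≗ s)))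
      run

  -- Any enabled flip may be fired first: the flips preceding it in a run touch
  -- none of its slots, hence commute with it.
  exchange : ∀ {σ∞ σ ℓ k e τ} → Enabled σ ℓ e τ → Run σ∞ σ ℓ k →
             ∃₂ λ w k′ → k ≡ suc k′ × Run σ∞ (apply σ e τ) (relabel σ ℓ e w) k′
  exchange en (halt quiet _) =
    let c , eq , _ = labelled en 0F in ⊥-elim (label≢idle c _ (trans (sym eq) (quiet _)))
  exchange {σ = σ} {ℓ} {e = e} {τ} en (fire {e = e₁} {τ₁} w₁ en₁ σ₁≗ ℓ₁≗ run)
    with e ≟ e₁
  ... | yes refl rewrite enabled-rule en en₁ =
    w₁ , _ , refl , run-cong (sym ∘ σ₁≗) (sym ∘ ℓ₁≗) run
  ... | no e≢e₁ =
    let disj = enabled-disjoint en en₁ e≢e₁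
        disj₁ = λ j k → ≢-sym (disj k j)
        agree = apply-outside σ e₁ τ₁ (touched σ e) disj₁
        agreeℓ = relabel-outside σ ℓ e₁ w₁ (touched σ e) disj₁
        en′ = enabled-local agree agreeℓ en
        w , k′ , eq , run′ = exchange en′ (run-cong (sym ∘ σ₁≗) (sym ∘ ℓ₁≗) run)
        en₁′ = enabled-local (apply-outside σ e τ (touched σ e₁) disj)
                             (relabel-outside σ ℓ e w (touched σ e₁) disj) en₁
    in w , suc k′ , cong suc eq ,
       fire w₁ en₁′ (apply-comm σ e₁ e τ₁ τ disj₁)
                    (relabel-comm σ e₁ e τ₁ τ disj₁ ℓ w₁ w) run′

  -- The relabellings in `ws` are listed in the order in which this search fires the flips, not in
  -- the order of the original path. The number `k` only bounds the count of flips; what is left of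
  -- the code after the last one is ignored.
  decode : (k : ℕ) → State M n → Labelling → Fin (#relabellings ^ k) → State M n
  decode zero    σ ℓ ws = σ
  decode (suc k) σ ℓ ws with any? (λ e → any? (λ τ → enabled? σ ℓ e τ))
  ... | no _            = σ
  ... | yes (e , τ , _) =
    let w , ws′ = remQuot {#relabellings} (#relabellings ^ k) ws
    in decode k (apply σ e τ) (relabel σ ℓ e w) ws′

  -- Whichever enabled flip the search returns, `exchange` moves it to the front of the remaining
  -- run and yields the relabelling to be put into the code.
  decode-complete : ∀ {σ∞} K {σ ℓ k} → k ≤ K → Run σ∞ σ ℓ k → ∃ λ ws → decode K σ ℓ ws ≗ σ∞
  decode-complete zero    z≤n (halt _ fin) = zero , fin
  decode-complete (suc K) {σ} {ℓ} {k} k≤K run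
    with any? (λ e → any? (λ τ → enabled? σ ℓ e τ))
  -- The run has ended before the bound; any padding of the code will do.
  decode-complete (suc K) k≤K (halt quiet fin) | no _ =
    funToFin (λ (_ : Fin (suc K)) → relabelling (λ _ → idle)) , fin
  decode-complete (suc K) k≤K (fire {e = e} {τ} w en _ _ _) | no none =
    ⊥-elim (none (e , τ , en))
  decode-complete (suc K) {σ} {ℓ} k≤K run | yes (e , τ , en) with exchange en run
  decode-complete (suc K) {σ} {ℓ} (s≤s k≤K) run | yes (e , τ , en) | w , k′ , refl , run′
    with decode-complete K k≤K run′
  ... | ws , eq = combine w ws , λ s →
    trans (cong (λ p → decode K (apply σ e τ) (relabel σ ℓ e (proj₁ p)) (proj₂ p) s)
                (remQuot-combine w ws)) (eq s)

  -- What makes a change of state expressible by a rule at `e`: `next-in` and `ends-in` supply the 7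
  -- * 3 entries of the rule, `back` supplies the jumps for the labels.
  record Local (σ σ₁ : State M n) (e : Fin M) : Set where
    private
      t : Fin 7 → Fin M
      t = lookup (touched σ e)
      tail : Fin 7 → Fin n
      tail j = proj₁ (ends σ (t j))
    field
      closed  : ∀ k → ∃ λ j → succ σ (t k) ≡ t j
      back    : ∀ k → ∃ λ c → lookup (jumps σ (t k)) c ≡ e
      frame   : ∀ s → (∀ k → t k ≢ s) → σ₁ s ≡ σ s
      next-in : ∀ k → ∃ λ j → succ σ₁ (t k) ≡ t j
      ends-in : ∀ k → ∃₂ λ i j → ends σ₁ (t k) ≡ (tail i , tail j)

  -- Labels are built backwards. Those valid after the flip are overwritten at the touched slots by
  -- labels naming this flip, and the overwritten values become the relabelling that the flip
  -- performs.
  local⇒run : ∀ {σ∞ σ σ₁ ℓ₁ e k} → Local σ σ₁ e → Run σ∞ σ₁ ℓ₁ k →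
              ∃ λ ℓ → Run σ∞ σ ℓ (suc k)
  local⇒run {σ = σ} {σ₁} {ℓ₁} {e} loc run = ℓ , fire w enabled onState onLabels run
    where
    open Local loc hiding (closed)
    t : Vec (Fin M) 7
    t = touched σ e
    choice : Fin 7 → Fin 3 → Fin 7
    choice k 0F = proj₁ (next-in k)
    choice k 1F = proj₁ (ends-in k)
    choice k 2F = proj₁ (proj₂ (ends-in k))
    τ : Rule
    τ = rule choice
    labels : Fin 7 → Label
    labels k = label (proj₁ (back k)) τ
    ℓ : Labelling
    ℓ = update t ℓ₁ labels
    w : Relabelling
    w = relabelling (ℓ₁ ∘ lookup t)
    opaque
      unfolding newCell
      onTouched : ∀ k → σ₁ (lookup t k) ≡ newCell σ t τ k
      onTouched k rewrite entry-rule choice k 0F | entry-rule choice k 1F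
                        | entry-rule choice k 2F =
        cong₂ _,_ (proj₂ (next-in k)) (proj₂ (proj₂ (ends-in k)))
    onState : σ₁ ≗ apply σ e τ
    onState s = trans (update-unique t onTouched frame s) (sym (apply-at σ e τ refl s))
    onLabels : ℓ₁ ≗ relabel σ ℓ e w
    onLabels s =
      trans (update-unique t (λ k → sym (newLabel-relabelling (ℓ₁ ∘ lookup t) k))
                             (λ _ miss → sym (update-out t ℓ₁ labels miss)) s)
            (sym (relabel-at σ ℓ e w refl s))
    enabled : Enabled σ ℓ e τ
    enabled = record
      { labelled = λ k →
          let j , same , eq = update-in t k
          -- If a slot occurs twice in the list, its label was written through position `j`; the
          -- recorded jump still starts from the same slot and so ends at `e`.
          in proj₁ (back j) , eq ℓ₁ labels ,
             trans (cong (λ s → lookup (jumps σ s) (proj₁ (back j))) (sym same))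
                   (proj₂ (back j))
      ; closed = Local.closed loc
      }

-- Deleting and inserting an edge in a rotation system.

if-elim : (a b c d : Fin n) (P : X → Set) {x y : X} →
          (a ≡ b → c ≡ d → P x) → (¬ (a ≡ b × c ≡ d) → P y) →
          P (if eqb a b ∧ eqb c d then x else y)
if-elim a b c d P yep nope with a ≟ b | c ≟ d
... | yes p | yes q = yep p q
... | yes p | no ¬q = nope (¬q ∘ proj₂)
... | no ¬p | _     = nope (¬p ∘ proj₁)

rotDel-elim : (r : Fin n → Fin n → Fin n) (p q v z : Fin n) (P : Fin n → Set) →
  (v ≡ p → z ≡ q → P q) → (v ≡ q → z ≡ p → P p) →
  (v ≡ p → r p z ≡ q → P (r p q)) → (v ≡ q → r q z ≡ p → P (r q p)) →
  (¬ (v ≡ p × r p z ≡ q) → ¬ (v ≡ q × r q z ≡ p) → P (r v z)) →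
  P (rotDel r p q v z)
rotDel-elim r p q v z P c₁ c₂ c₃ c₄ c₅ =
  if-elim v p z q P c₁ λ _ → if-elim v q z p P c₂ λ _ →
  if-elim v p (r p z) q P c₃ λ ¬3 → if-elim v q (r q z) p P c₄ λ ¬4 → c₅ ¬3 ¬4

rotIns-elim : (r : Fin n → Fin n → Fin n) (x u y w v z : Fin n) (P : Fin n → Set) →
  (v ≡ x → z ≡ u → P y) →
  (¬ (v ≡ x × z ≡ u) → v ≡ x → z ≡ y → P (r x u)) →
  (¬ (v ≡ x × z ≡ y) → v ≡ y → z ≡ w → P x) →
  (¬ (v ≡ y × z ≡ w) → v ≡ y → z ≡ x → P (r y w)) →
  (¬ (v ≡ x × z ≡ y) → ¬ (v ≡ y × z ≡ x) → P (r v z)) →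
  P (rotIns r x u y w v z)
rotIns-elim r x u y w v z P c₁ c₂ c₃ c₄ c₅ =
  if-elim v x z u P c₁ λ ¬1 → if-elim v x z y P (c₂ ¬1) λ ¬2 →
  if-elim v y z w P (c₃ ¬2) λ ¬3 → if-elim v y z x P (c₄ ¬3) λ ¬4 → c₅ ¬2 ¬4

true≢false : true ≢ false
true≢false ()

module _ (x y p q : Fin n) where

  isEdge-false : (x , y) ≢ (p , q) → (x , y) ≢ (q , p) → isEdge x y p q ≡ false
  isEdge-false ≢pq ≢qp with x ≟ p | y ≟ q | x ≟ q | y ≟ p
  ... | yes refl | yes refl | _        | _        = ⊥-elim (≢pq refl)
  ... | _        | _        | yes refl | yes refl = ⊥-elim (≢qp refl)
  ... | yes _    | no _     | yes _    | no _     = refl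
  ... | yes _    | no _     | no _     | _        = refl
  ... | no _     | _        | yes _    | no _     = refl
  ... | no _     | _        | no _     | _        = refl

  isEdge-true : isEdge x y p q ≡ true → (x , y) ≡ (p , q) ⊎ (x , y) ≡ (q , p)
  isEdge-true eq with x ≟ p | y ≟ q | x ≟ q | y ≟ p
  isEdge-true eq | yes refl | yes refl | _        | _        = inj₁ refl
  isEdge-true eq | yes _    | no _     | yes refl | yes refl = inj₂ refl
  isEdge-true eq | no _     | _        | yes refl | yes refl = inj₂ refl
  isEdge-true () | yes _    | no _     | yes _    | no _
  isEdge-true () | yes _    | no _     | no _     | _
  isEdge-true () | no _     | _        | yes _    | no _
  isEdge-true () | no _     | _        | no _     | _

isEdge-refl : (p q : Fin n) → isEdge p q p q ≡ true
isEdge-refl p q with p ≟ p | q ≟ q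
... | yes _ | yes _ = refl
... | no ≢  | _     = ⊥-elim (≢ refl)
... | yes _ | no ≢  = ⊥-elim (≢ refl)

isEdge-swap : (p q : Fin n) → isEdge q p p q ≡ true
isEdge-swap p q with q ≟ p | p ≟ q | q ≟ q | p ≟ p
... | yes _ | yes _ | _     | _     = refl
... | yes _ | no _  | yes _ | yes _ = refl
... | no _  | _     | yes _ | yes _ = refl
... | _     | _     | no ≢  | _     = ⊥-elim (≢ refl)
... | _     | _     | yes _ | no ≢  = ⊥-elim (≢ refl)

-- Embedding-level account of a flip: S is the set of darts of the two faces
-- at the flipped edge {p , q}.
module Surgery
  (A : Fin n → Fin n → Bool) (r : Fin n → Fin n → Fin n)
  (p q x y u w : Fin n) (S : Dart n → Set)
  (S-dart : ∀ {d} → S d → IsDart A d)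
  (S-step : ∀ {d} → S d → S (step r d))
  (S-pred : ∀ {d} → IsDart A d → step r d ≡ (p , q) ⊎ step r d ≡ (q , p) → S d)
  (S-pq : S (p , q)) (S-qp : S (q , p))
  (irrefl : ∀ v → A v v ≡ false) (symm : ∀ v z → A v z ≡ A z v)
  (no-leaf-p : r p q ≢ q) (no-leaf-q : r q p ≢ p)
  (xy≢pq : isEdge x y p q ≡ false) (no-xy : adjDel A p q x y ≡ false) (x≢y : x ≢ y)
  where

  A⁻ = adjDel A p q
  r⁻ = rotDel r p q
  r′ = rotIns r⁻ x u y w

  Region : Dart n → Set
  Region d = S d × d ≢ (p , q) × d ≢ (q , p)

  p≢q : p ≢ q
  p≢q refl = true≢false (trans (sym (S-dart S-pq)) (irrefl p))

  -- The pair {x , y} is absent after the deletion and is not the deleted pair, so it was absent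
  -- before.
  not-new : ∀ {d} → IsDart A d → d ≢ (x , y) × d ≢ (y , x)
  not-new {d} dart = ≢xy , λ { refl → ≢xy′ (trans (symm x y) dart) }
    where
    ≢xy′ : A x y ≢ true
    ≢xy′ Axy = true≢false (trans (sym (cong₂ (λ a b → a ∧ not b) Axy xy≢pq)) no-xy)
    ≢xy : d ≢ (x , y)
    ≢xy refl = ≢xy′ dart

  region-new : ∀ {d} → Region d → d ≢ (x , y) × d ≢ (y , x)
  region-new (s , _) = not-new (S-dart s)

  region-start : Region (step r (p , q))
  region-start = S-step S-pq , (λ eq → p≢q (cong proj₁ (sym eq))) ,
                 (λ eq → no-leaf-q (cong proj₂ eq))

  -- Where the face walk would enter the deleted edge, it now continues with the dart after the
  -- reverse of that edge, a dart of the other old face. As `p` and `q` are not leaves, this dart is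
  -- not a deleted one.
  del-step : ∀ {d} → Region d → Region (step r⁻ d)
  del-step {g , h} (s , ≢pq , ≢qp) = rotDel-elim r p q h g (λ z → Region (h , z))
    (λ { refl refl → ⊥-elim (≢qp refl) })
    (λ { refl refl → ⊥-elim (≢pq refl) })
    (λ { refl _ → S-step S-qp , no-leaf-p ∘ cong proj₂ , p≢q ∘ cong proj₁ })
    (λ { refl _ → region-start })
    (λ ¬p ¬q → S-step s ,
       (λ { eq → ¬p (cong proj₁ eq , trans (cong (λ v → r v g) (sym (cong proj₁ eq))) (cong proj₂ eq)) }) ,
       (λ { eq → ¬q (cong proj₁ eq , trans (cong (λ v → r v g) (sym (cong proj₁ eq))) (cong proj₂ eq)) }))

  region-iter : ∀ {d} → SameFace r⁻ (step r (p , q)) d → Region d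
  region-iter (k , refl) = go k
    where
    go : ∀ k → Region (iter (step r⁻) k (step r (p , q)))
    go zero    = region-start
    go (suc k) = del-step (go k)

  del-frame : ∀ {d} → IsDart A d → ¬ S d → step r⁻ d ≡ step r d
  del-frame {g , h} dart ∉S = rotDel-elim r p q h g (λ z → (h , z) ≡ (h , r h g))
    (λ { refl refl → ⊥-elim (∉S S-qp) })
    (λ { refl refl → ⊥-elim (∉S S-pq) })
    (λ { refl eq → ⊥-elim (∉S (S-pred dart (inj₁ (cong (p ,_) eq)))) })
    (λ { refl eq → ⊥-elim (∉S (S-pred dart (inj₂ (cong (q ,_) eq)))) })
    (λ _ _ → refl)

  module Insert (ux : Region (u , x)) (wy : Region (w , y)) where

    ins-xy : step r′ (x , y) ≡ step r⁻ (w , y)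
    ins-xy = rotIns-elim r⁻ x u y w y x (λ z → (y , z) ≡ (y , r⁻ y w))
      (λ y≡x _ → ⊥-elim (x≢y (sym y≡x)))
      (λ _ y≡x _ → ⊥-elim (x≢y (sym y≡x)))
      (λ { _ _ refl → ⊥-elim (proj₁ (region-new wy) refl) })
      (λ _ _ _ → refl)
      (λ _ ≢ → ⊥-elim (≢ (refl , refl)))

    ins-yx : step r′ (y , x) ≡ step r⁻ (u , x)
    ins-yx = rotIns-elim r⁻ x u y w x y (λ z → (x , z) ≡ (x , r⁻ x u))
      (λ { _ refl → ⊥-elim (proj₂ (region-new ux) refl) })
      (λ _ _ _ → refl)
      (λ ≢ _ _ → ⊥-elim (≢ (refl , refl)))
      (λ ≢ x≡y _ → ⊥-elim (x≢y x≡y))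
      (λ ≢ _ → ⊥-elim (≢ (refl , refl)))

    Inserted : Dart n → Set
    Inserted d = Region d ⊎ d ≡ (x , y) ⊎ d ≡ (y , x)

    ins-region : ∀ {d} → Region d → Inserted (step r′ d)
    ins-region {g , h} reg = rotIns-elim r⁻ x u y w h g (λ z → Inserted (h , z))
      (λ { refl _ → inj₂ (inj₁ refl) })
      (λ { _ refl refl → ⊥-elim (proj₂ (region-new reg) refl) })
      (λ { _ refl _ → inj₂ (inj₂ refl) })
      (λ { _ refl refl → ⊥-elim (proj₁ (region-new reg) refl) })
      (λ _ _ → inj₁ (del-step reg))

    ins-frame : ∀ {d} → IsDart A d → ¬ S d → step r′ d ≡ step r d
    ins-frame {g , h} dart ∉S = rotIns-elim r⁻ x u y w h g (λ z → (h , z) ≡ (h , r h g))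
      (λ { refl refl → ⊥-elim (∉S (proj₁ ux)) })
      (λ { _ refl refl → ⊥-elim (proj₂ (not-new dart) refl) })
      (λ { _ refl refl → ⊥-elim (∉S (proj₁ wy)) })
      (λ { _ refl refl → ⊥-elim (proj₁ (not-new dart) refl) })
      (λ _ _ → del-frame dart ∉S)

-- Flips of pseudo-triangulations as steps of the machine.

module _ {M n : ℕ} (tw : Fin M → Fin M) where
  open Machine {M} {n} tw

  -- Slots correspond bijectively to the darts of `T`. The reversal `tw` is a parameter outside the
  -- record because one and the same `tw` has to serve all graphs on a flip path.
  record Represents (T : PPT n) (σ : State M n) : Set where
    field
      loc       : Dart n → Fin M
      ends-dart : ∀ s → IsDart (adj T) (ends σ s)
      loc-ends  : ∀ s → loc (ends σ s) ≡ s
      ends-loc  : ∀ {d} → IsDart (adj T) d → ends σ (loc d) ≡ d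
      ends-tw   : ∀ s → ends σ (tw s) ≡ swap (ends σ s)
      ends-next : ∀ s → ends σ (succ σ s) ≡ step (rot T) (ends σ s)

    ends-injective : ∀ {s s′} → ends σ s ≡ ends σ s′ → s ≡ s′
    ends-injective {s} {s′} eq = trans (sym (loc-ends s)) (trans (cong loc eq) (loc-ends s′))

    tw-involutive : ∀ s → tw (tw s) ≡ s
    tw-involutive s = ends-injective (trans (ends-tw (tw s)) (cong swap (ends-tw s)))

  module Touched
    (σ : State M n) (e : Fin M) (tw-tw : tw (tw e) ≡ e)
    (Δ : succ σ (succ σ (succ σ e)) ≡ e)
    (F : succ σ (succ σ (succ σ (tw e))) ≡ tw e
       ⊎ succ σ (succ σ (succ σ (succ σ (tw e)))) ≡ tw e)
    where

    φ : Fin M → Fin M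
    φ = succ σ

    In : Fin M → Set
    In s = ∃ λ k → lookup (touched σ e) k ≡ s

    opaque
      unfolding touched jumps

      in-edge : In e
      in-edge = 0F , refl

      in-twin : In (tw e)
      in-twin = 3F , refl

      in-next : ∀ {s} → In s → In (φ s)
      in-next (0F , refl) = 1F , refl
      in-next (1F , refl) = 2F , refl
      in-next (2F , refl) = 0F , sym Δ
      in-next (3F , refl) = 4F , refl
      in-next (4F , refl) = 5F , refl
      in-next (5F , refl) = 6F , refl
      in-next (6F , refl) =
        [ (λ three → 4F , cong φ (sym three))
        , (λ four → 3F , sym four) ]′ F

      in-pred-edge : (∀ {s s′} → φ s ≡ φ s′ → s ≡ s′) → ∀ {s} → φ s ≡ e → In s
      in-pred-edge φ-injective eq = 2F , φ-injective (trans Δ (sym eq))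

      in-pred-twin : (∀ {s s′} → φ s ≡ φ s′ → s ≡ s′) → ∀ {s} → φ s ≡ tw e → In s
      in-pred-twin φ-injective eq =
        [ (λ three → 5F , φ-injective (trans three (sym eq)))
        , (λ four → 6F , φ-injective (trans four (sym eq))) ]′ F

      -- Within the triangle, at most two successor steps lead back to `e`. In the other face one
      -- walks on to `tw e` and crosses over; the length of that walk depends on whether the face
      -- has 3 or 4 sides.
      back : ∀ k → ∃ λ c → lookup (jumps σ (lookup (touched σ e) k)) c ≡ e
      back 0F = 0F , refl
      back 1F = 2F , Δ
      back 2F = 1F , Δ
      back 3F = 3F , tw-tw
      back 4F =
        [ (λ three → 5F , trans (cong tw three) tw-tw)
        , (λ four → 6F , trans (cong tw four) tw-tw) ]′ F
      back 5F =
        [ (λ three → 4F , trans (cong tw three) tw-tw)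
        , (λ four → 5F , trans (cong tw four) tw-tw) ]′ F
      back 6F =
        [ (λ three → 3F , trans (cong tw three) tw-tw)
        , (λ four → 4F , trans (cong tw four) tw-tw) ]′ F

  -- The slots `e` and `tw e` of the removed edge are reused for the darts (x , y) and (y , x), and
  -- every other slot keeps its dart. Only the successors of slots on the two old faces can change.
  represents-flip : ∀ {a b c T T′ σ} → Represents T σ → Flip a b c T T′ →
                    ∃₂ λ σ₁ e → Local σ σ₁ e × Represents T′ σ₁
  represents-flip {T = T} {T′} {σ} rep
    ( ((irrefl , symm) , (_ , _ , rot-inj , _) , _ , _ , _ , _ , _ , _ , _ , _ , _ , faces , _)
    , ((_ , symm′) , (rot-adj′ , _) , _)
    , p , q , x , y , u , w , Apq , (_ , cycle₃ , _) , ¬outΔ , ¬outF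
    , x≢y , xy≢pq , no-xy , _ , ux , _ , wy , adj≡ , rot≡ , _ )
    = σ₁ , e , local , rep₁
    where
    open Represents rep
    A = adj T
    r = rot T

    Aqp : A q p ≡ true
    Aqp = trans (symm q p) Apq

    e : Fin M
    e = loc (p , q)

    ends-e : ends σ e ≡ (p , q)
    ends-e = ends-loc Apq

    ends-tw-e : ends σ (tw e) ≡ (q , p)
    ends-tw-e = trans (ends-tw e) (cong swap ends-e)

    ends-iter : ∀ k s → ends σ (iter (succ σ) k s) ≡ iter (step r) k (ends σ s)
    ends-iter zero    s = refl
    ends-iter (suc k) s = trans (ends-next _) (cong (step r) (ends-iter k s))

    closes : ∀ k s {d} → ends σ s ≡ d → iter (step r) k d ≡ d → iter (succ σ) k s ≡ s
    closes k s refl eq = ends-injective (trans (ends-iter k s) eq)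

    F : iter (succ σ) 3 (tw e) ≡ tw e ⊎ iter (succ σ) 4 (tw e) ≡ tw e
    F with faces (q , p) Aqp ¬outF
    ... | _ , inj₁ refl , (cycle , _) , _ = inj₁ (closes 3 (tw e) ends-tw-e cycle)
    ... | _ , inj₂ refl , (cycle , _) , _ = inj₂ (closes 4 (tw e) ends-tw-e cycle)

    no-leaf : ∀ v z → A v z ≡ true → ¬ SameFace r _ (v , z) → r z v ≢ v
    no-leaf v z Avz ¬out eq with faces (v , z) Avz ¬out
    -- At a leaf `z` the face would turn back, and its tails at positions 0 and 2 would both be `v`.
    ... | _ , inj₁ refl , (_ , simple) , _ = simple 0 2 (s≤s z≤n) (s≤s (s≤s (s≤s z≤n))) (sym eq)
    ... | _ , inj₂ refl , (_ , simple) , _ = simple 0 2 (s≤s z≤n) (s≤s (s≤s (s≤s z≤n))) (sym eq)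

    open Touched σ e (tw-involutive e) (closes 3 e ends-e cycle₃) F

    φ-injective : ∀ {s s′} → succ σ s ≡ succ σ s′ → s ≡ s′
    φ-injective {s} {s′} eq = ends-injective (step-injective (ends-dart s) (ends-dart s′)
      (trans (sym (ends-next s)) (trans (cong (ends σ) eq) (ends-next s′))))
      where
      step-injective : ∀ {d d′} → IsDart A d → IsDart A d′ → step r d ≡ step r d′ → d ≡ d′
      step-injective {g , h} {g′ , h′} dart dart′ eq with cong proj₁ eq
      ... | refl = cong (_, h) (rot-inj h g g′ (trans (symm h g) dart) (trans (symm h g′) dart′)
                                 (cong proj₂ eq))

    S : Dart n → Set
    S d = ∃ λ s → In s × ends σ s ≡ d

    S-dart : ∀ {d} → S d → IsDart A d
    S-dart (s , _ , refl) = ends-dart s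

    S-step : ∀ {d} → S d → S (step r d)
    S-step (s , i , refl) = succ σ s , in-next i , ends-next s

    S-pred : ∀ {d} → IsDart A d → step r d ≡ (p , q) ⊎ step r d ≡ (q , p) → S d
    S-pred {d} dart eq = loc d , inS eq , ends-loc dart
      where
      ends-next-loc : ends σ (succ σ (loc d)) ≡ step r d
      ends-next-loc = trans (ends-next _) (cong (step r) (ends-loc dart))
      inS : step r d ≡ (p , q) ⊎ step r d ≡ (q , p) → In (loc d)
      inS (inj₁ eq) = in-pred-edge φ-injective
        (ends-injective (trans ends-next-loc (trans eq (sym ends-e))))
      inS (inj₂ eq) = in-pred-twin φ-injective
        (ends-injective (trans ends-next-loc (trans eq (sym ends-tw-e))))

    S-in : ∀ {s} → S (ends σ s) → In s
    S-in (s′ , i , eq) = subst In (ends-injective eq) i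

    open Surgery A r p q x y u w S S-dart S-step S-pred
      (e , in-edge , ends-e) (tw e , in-twin , ends-tw-e) irrefl symm
      (no-leaf q p Aqp ¬outF) (no-leaf p q Apq ¬outΔ) xy≢pq no-xy x≢y
      hiding (A⁻; r⁻)

    open Insert (region-iter ux) (region-iter wy)

    tw-e≢e : tw e ≢ e
    tw-e≢e eq = p≢q (cong proj₁ (trans (sym ends-e) (trans (cong (ends σ) (sym eq)) ends-tw-e)))

    _≟ᵈ_ : (d d′ : Dart n) → Dec (d ≡ d′)
    _≟ᵈ_ = ≡-dec _≟_ _≟_

    ends₁ : Fin M → Dart n
    ends₁ s with s ≟ e | s ≟ tw e
    ... | yes _ | _     = x , y
    ... | no _  | yes _ = y , x
    ... | no _  | no _  = ends σ s

    loc₁ : Dart n → Fin M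
    loc₁ d with d ≟ᵈ (x , y) | d ≟ᵈ (y , x)
    ... | yes _ | _     = e
    ... | no _  | yes _ = tw e
    ... | no _  | no _  = loc d

    ends₁-e : ends₁ e ≡ (x , y)
    ends₁-e with e ≟ e | e ≟ tw e
    ... | yes _ | _ = refl
    ... | no ≢  | _ = ⊥-elim (≢ refl)

    ends₁-tw-e : ends₁ (tw e) ≡ (y , x)
    ends₁-tw-e with tw e ≟ e | tw e ≟ tw e
    ... | yes eq | _     = ⊥-elim (tw-e≢e eq)
    ... | no _   | yes _ = refl
    ... | no _   | no ≢  = ⊥-elim (≢ refl)

    ends₁-old : ∀ {s} → s ≢ e → s ≢ tw e → ends₁ s ≡ ends σ s
    ends₁-old {s} ≢e ≢tw with s ≟ e | s ≟ tw e
    ... | yes eq | _      = ⊥-elim (≢e eq)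
    ... | no _   | yes eq = ⊥-elim (≢tw eq)
    ... | no _   | no _   = refl

    loc₁-xy : loc₁ (x , y) ≡ e
    loc₁-xy with (x , y) ≟ᵈ (x , y) | (x , y) ≟ᵈ (y , x)
    ... | yes _ | _ = refl
    ... | no ≢  | _ = ⊥-elim (≢ refl)

    loc₁-yx : loc₁ (y , x) ≡ tw e
    loc₁-yx with (y , x) ≟ᵈ (x , y) | (y , x) ≟ᵈ (y , x)
    ... | yes eq | _     = ⊥-elim (x≢y (cong proj₂ eq))
    ... | no _   | yes _ = refl
    ... | no _   | no ≢  = ⊥-elim (≢ refl)

    loc₁-old : ∀ {d} → d ≢ (x , y) × d ≢ (y , x) → loc₁ d ≡ loc d
    loc₁-old {d} (≢xy , ≢yx) with d ≟ᵈ (x , y) | d ≟ᵈ (y , x)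
    ... | yes eq | _      = ⊥-elim (≢xy eq)
    ... | no _   | yes eq = ⊥-elim (≢yx eq)
    ... | no _   | no _   = refl

    data Side (s : Fin M) : Set where
      edge : s ≡ e → Side s
      twin : s ≡ tw e → Side s
      old  : s ≢ e → s ≢ tw e → Side s

    side : ∀ s → Side s
    side s with s ≟ e | s ≟ tw e
    ... | yes eq | _      = edge eq
    ... | no _   | yes eq = twin eq
    ... | no ≢e  | no ≢tw = old ≢e ≢tw

    ends-old : ∀ {s} → s ≢ e → s ≢ tw e → ends σ s ≢ (p , q) × ends σ s ≢ (q , p)
    ends-old ≢e ≢tw = (λ eq → ≢e (ends-injective (trans eq (sym ends-e)))) ,
                      (λ eq → ≢tw (ends-injective (trans eq (sym ends-tw-e))))

    dart′-new : IsDart (adj T′) (x , y)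
    dart′-new = trans (adj≡ x y) (trans (cong₂ _∨_ no-xy refl) (isEdge-refl x y))

    dart′-old : ∀ {d} → IsDart A d → d ≢ (p , q) → d ≢ (q , p) → IsDart (adj T′) d
    dart′-old {g , h} dart ≢pq ≢qp rewrite adj≡ g h | dart | isEdge-false g h p q ≢pq ≢qp = refl

    dart′-view : ∀ {d} → IsDart (adj T′) d →
                 (IsDart A d × d ≢ (p , q) × d ≢ (q , p)) ⊎ d ≡ (x , y) ⊎ d ≡ (y , x)
    dart′-view {g , h} dart with A g h in Agh | isEdge g h p q in gh≟pq | trans (sym (adj≡ g h)) dart
    ... | true  | false | _ =
      inj₁ (refl , (λ { refl → true≢false (trans (sym (isEdge-refl p q)) gh≟pq) }) ,
                   (λ { refl → true≢false (trans (sym (isEdge-swap p q)) gh≟pq) }))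
    ... | true  | true  | new = inj₂ (isEdge-true g h x y new)
    ... | false | _     | new = inj₂ (isEdge-true g h x y new)

    σ₁ : State M n
    σ₁ s = loc₁ (step (rot T′) (ends₁ s)) , ends₁ s

    step≡ : ∀ d → step (rot T′) d ≡ step r′ d
    step≡ (g , h) = cong (h ,_) (rot≡ h g)

    loc₁-in : ∀ {d} → Inserted d → In (loc₁ d)
    loc₁-in (inj₂ (inj₁ refl)) = subst In (sym loc₁-xy) in-edge
    loc₁-in (inj₂ (inj₂ refl)) = subst In (sym loc₁-yx) in-twin
    loc₁-in (inj₁ reg@((s , i , refl) , _)) =
      subst In (sym (trans (loc₁-old (region-new reg)) (loc-ends s))) i

    ends-inserted : ∀ s → In s → Inserted (step (rot T′) (ends₁ s))
    ends-inserted s i rewrite step≡ (ends₁ s) with side s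
    ... | edge refl rewrite ends₁-e | ins-xy = inj₁ (del-step (region-iter wy))
    ... | twin refl rewrite ends₁-tw-e | ins-yx = inj₁ (del-step (region-iter ux))
    ... | old ≢e ≢tw rewrite ends₁-old ≢e ≢tw =
      ins-region ((s , i , refl) , ends-old ≢e ≢tw)

    Tail : Fin n → Set
    Tail v = ∃ λ j → v ≡ proj₁ (ends σ (lookup (touched σ e) j))

    tail₁ : ∀ {d} → S d → Tail (proj₁ d)
    tail₁ (_ , (j , refl) , refl) = j , refl

    tail₂ : ∀ {d} → S d → Tail (proj₂ d)
    tail₂ s = tail₁ (S-step s)

    -- The new end vertices `x` and `y` are heads of the region darts (u , x) and (w , y), and the
    -- head of a dart is the tail of the next dart on its face.
    tails : ∀ s → In s → Tail (proj₁ (ends₁ s)) × Tail (proj₂ (ends₁ s))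
    tails s i with side s
    ... | edge refl rewrite ends₁-e =
      tail₂ (proj₁ (region-iter ux)) , tail₂ (proj₁ (region-iter wy))
    ... | twin refl rewrite ends₁-tw-e =
      tail₂ (proj₁ (region-iter wy)) , tail₂ (proj₁ (region-iter ux))
    ... | old ≢e ≢tw rewrite ends₁-old ≢e ≢tw = tail₁ (s , i , refl) , tail₂ (s , i , refl)

    local : Local σ σ₁ e
    local = record
      { closed  = λ k → let j , eq = in-next (k , refl) in j , sym eq
      ; back    = back
      ; frame   = frame
      ; next-in = λ k → let j , eq = loc₁-in (ends-inserted _ (k , refl)) in j , sym eq
      ; ends-in = λ k → let (i , p) , (j , q) = tails _ (k , refl) in i , j , cong₂ _,_ p q
      }
      where
      frame : ∀ s → (∀ k → lookup (touched σ e) k ≢ s) → σ₁ s ≡ σ s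
      frame s miss = cong₂ _,_ next≡ ends≡
        where
        ∉ : ∀ {s′} → In s′ → s ≢ s′
        ∉ (k , eq) refl = miss k eq
        ends≡ : ends₁ s ≡ ends σ s
        ends≡ = ends₁-old (∉ in-edge) (∉ in-twin)
        open ≡-Reasoning
        next≡ : loc₁ (step (rot T′) (ends₁ s)) ≡ succ σ s
        next≡ = begin
          loc₁ (step (rot T′) (ends₁ s))  ≡⟨ cong (loc₁ ∘ step (rot T′)) ends≡ ⟩
          loc₁ (step (rot T′) (ends σ s)) ≡⟨ cong loc₁ (step≡ (ends σ s)) ⟩
          loc₁ (step r′ (ends σ s))
            ≡⟨ cong loc₁ (ins-frame (ends-dart s) (λ inS → ∉ (S-in inS) refl)) ⟩
          loc₁ (step r (ends σ s))        ≡⟨ cong loc₁ (ends-next s) ⟨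
          loc₁ (ends σ (succ σ s))        ≡⟨ loc₁-old (not-new (ends-dart (succ σ s))) ⟩
          loc (ends σ (succ σ s))         ≡⟨ loc-ends (succ σ s) ⟩
          succ σ s ∎

    ends₁-loc₁ : ∀ {d} → IsDart (adj T′) d → ends₁ (loc₁ d) ≡ d
    ends₁-loc₁ {d} dart with dart′-view dart
    ... | inj₂ (inj₁ refl) = trans (cong ends₁ loc₁-xy) ends₁-e
    ... | inj₂ (inj₂ refl) = trans (cong ends₁ loc₁-yx) ends₁-tw-e
    ... | inj₁ (dartA , ≢pq , ≢qp) = begin
      ends₁ (loc₁ d)    ≡⟨ cong ends₁ (loc₁-old (not-new dartA)) ⟩
      ends₁ (loc d)     ≡⟨ ends₁-old (λ eq → ≢pq (pull eq ends-e)) (λ eq → ≢qp (pull eq ends-tw-e)) ⟩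
      ends σ (loc d)    ≡⟨ ends-loc dartA ⟩
      d ∎
      where
      open ≡-Reasoning
      pull : ∀ {s d′} → loc d ≡ s → ends σ s ≡ d′ → d ≡ d′
      pull eq eq′ = trans (sym (ends-loc dartA)) (trans (cong (ends σ) eq) eq′)

    ends₁-dart : ∀ s → IsDart (adj T′) (ends₁ s)
    ends₁-dart s with side s
    ... | edge refl  rewrite ends₁-e = dart′-new
    ... | twin refl  rewrite ends₁-tw-e = trans (symm′ y x) dart′-new
    ... | old ≢e ≢tw rewrite ends₁-old ≢e ≢tw =
      let ≢pq , ≢qp = ends-old ≢e ≢tw in dart′-old (ends-dart s) ≢pq ≢qp

    rep₁ : Represents T′ σ₁
    rep₁ = record
      { loc       = loc₁
      ; ends-dart = ends₁-dart
      ; loc-ends  = loc₁-ends₁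
      ; ends-loc  = ends₁-loc₁
      ; ends-tw   = ends₁-tw
      ; ends-next = λ s → ends₁-loc₁ (step-dart (ends₁-dart s))
      }
      where
      loc₁-ends₁ : ∀ s → loc₁ (ends₁ s) ≡ s
      loc₁-ends₁ s with side s
      ... | edge refl  = trans (cong loc₁ ends₁-e) loc₁-xy
      ... | twin refl  = trans (cong loc₁ ends₁-tw-e) loc₁-yx
      ... | old ≢e ≢tw = trans (cong loc₁ (ends₁-old ≢e ≢tw))
                               (trans (loc₁-old (not-new (ends-dart s))) (loc-ends s))
      ends₁-tw : ∀ s → ends₁ (tw s) ≡ swap (ends₁ s)
      ends₁-tw s with side s
      ... | edge refl = trans ends₁-tw-e (cong swap (sym ends₁-e))
      ... | twin refl = trans (cong ends₁ (tw-involutive e))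
                              (trans ends₁-e (cong swap (sym ends₁-tw-e)))
      ... | old ≢e ≢tw = trans (ends₁-old ≢tw′ ≢e′)
                               (trans (ends-tw s) (cong swap (sym (ends₁-old ≢e ≢tw))))
        where
        ≢tw′ : tw s ≢ e
        ≢tw′ eq = ≢tw (trans (sym (tw-involutive s)) (cong tw eq))
        ≢e′ : tw s ≢ tw e
        ≢e′ eq = ≢e (trans (sym (tw-involutive s)) (trans (cong tw eq) (tw-involutive e)))
      step-dart : ∀ {d} → IsDart (adj T′) d → IsDart (adj T′) (step (rot T′) d)
      step-dart {g , h} dart = rot-adj′ h g (trans (symm′ h g) dart)

  -- The induction produces labels from the end of the path. The last graph `T∞` is kept apart from
  -- `T′`, to which it is only pointwise equal.
  flips⇒run : ∀ {a b c T T′ k σ} → Represents T σ → FlipPath a b c T T′ k →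
              ∃₂ λ σ∞ T∞ → Represents T∞ σ∞ × SamePPT T∞ T′ × ∃ λ ℓ → Run σ∞ σ ℓ k
  flips⇒run {T = T} {σ = σ} rep (done same) =
    σ , T , rep , same , (λ _ → idle) , halt (λ _ → refl) (λ _ → refl)
  flips⇒run rep (next flip path) =
    let σ₁ , e , loc , rep₁ = represents-flip rep flip
        σ∞ , T∞ , rep∞ , same , ℓ₁ , run = flips⇒run rep₁ path
    in σ∞ , T∞ , rep∞ , same , local⇒run loc run

-- Iteration and faces, and the fans as 4-PPTs.

iter-shift : (f : X → X) (k : ℕ) (x : X) → iter f k (f x) ≡ f (iter f k x)
iter-shift f zero    x = refl
iter-shift f (suc k) x = cong f (iter-shift f k x)

iter-+ : (f : X → X) (j k : ℕ) (x : X) → iter f j (iter f k x) ≡ iter f (j + k) x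
iter-+ f zero    k x = refl
iter-+ f (suc j) k x = cong f (iter-+ f j k x)

iter-conj : {B : Set} {f : X → X} {g : B → B} (h : X → B) → (∀ x → g (h x) ≡ h (f x)) →
            ∀ k x → iter g k (h x) ≡ h (iter f k x)
iter-conj h eq zero    x = refl
iter-conj {f = f} {g} h eq (suc k) x = trans (cong g (iter-conj h eq k x)) (eq (iter f k x))

iter-inverse : {f g : X → X} → (∀ x → g (f x) ≡ x) → ∀ k x → iter g k (iter f k x) ≡ x
iter-inverse inv zero    x = refl
iter-inverse {f = f} {g} inv (suc k) x = begin
  g (iter g k (f (iter f k x))) ≡⟨ cong (g ∘ iter g k) (iter-shift f k x) ⟨
  g (iter g k (iter f k (f x))) ≡⟨ cong g (iter-inverse inv k (f x)) ⟩
  g (f x)                       ≡⟨ inv x ⟩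
  x ∎
  where open ≡-Reasoning

sumFin-const : ∀ k c → sumFin k (λ _ → c) ≡ k * c
sumFin-const zero    c = refl
sumFin-const (suc k) c = cong (c +_) (sumFin-const k c)

reach-trans : {A : Fin n → Fin n → Bool} {u v w : Fin n} → Reach A u v → Reach A v w → Reach A u w
reach-trans here        q = q
reach-trans (there e p) q = there e (reach-trans p q)

module _ {r : Fin n → Fin n → Fin n} where

  face-trans : ∀ {d d′ d″} → SameFace r d d′ → SameFace r d′ d″ → SameFace r d d″
  face-trans {d} (k , refl) (j , refl) = j + k , sym (iter-+ (step r) j k d)

  face-step : ∀ {d d′} → SameFace r (step r d) d′ → SameFace r d d′
  face-step {d} (k , refl) = suc k , sym (iter-shift (step r) k d)

  step-face : ∀ {d d′} → SameFace r d d′ → SameFace r d (step r d′)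
  step-face (k , refl) = suc k , refl

module _ (f : ℕ → X) where

  distinct₃ : f 0 ≢ f 1 → f 0 ≢ f 2 → f 1 ≢ f 2 → ∀ i j → i < j → j < 3 → f i ≢ f j
  distinct₃ p q r 0 1 _ _ = p
  distinct₃ p q r 0 2 _ _ = q
  distinct₃ p q r 1 2 _ _ = r
  distinct₃ p q r _ (suc (suc (suc _))) _ (s≤s (s≤s (s≤s ())))
  distinct₃ p q r (suc _) 1 (s≤s ()) _
  distinct₃ p q r (suc (suc _)) 2 (s≤s (s≤s ())) _

  distinct₄ : f 0 ≢ f 1 → f 0 ≢ f 2 → f 0 ≢ f 3 → f 1 ≢ f 2 → f 1 ≢ f 3 → f 2 ≢ f 3 →
              ∀ i j → i < j → j < 4 → f i ≢ f j
  distinct₄ p q r s t u 0 1 _ _ = p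
  distinct₄ p q r s t u 0 2 _ _ = q
  distinct₄ p q r s t u 0 3 _ _ = r
  distinct₄ p q r s t u 1 2 _ _ = s
  distinct₄ p q r s t u 1 3 _ _ = t
  distinct₄ p q r s t u 2 3 _ _ = u
  distinct₄ p q r s t u _ (suc (suc (suc (suc _)))) _ (s≤s (s≤s (s≤s (s≤s ()))))
  distinct₄ p q r s t u (suc _) 1 (s≤s ()) _
  distinct₄ p q r s t u (suc (suc _)) 2 (s≤s (s≤s ())) _
  distinct₄ p q r s t u (suc (suc (suc _))) 3 (s≤s (s≤s (s≤s ()))) _

-- The fan: the edge {0 , 1} together with all edges from 0 and 1 to the other
-- vertices.  Around 1 the neighbours other than 1 itself are indexed by
-- Fin (suc m) through besides₁, around 0 through suc, and nxt is the cyclic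
-- order around 1; the order around 0 is the reverse one.
module Fan {k : ℕ} where

  private
    m : ℕ
    m = suc k
    V : Set
    V = Fin (suc (suc m))

  besides₁ : Fin (suc m) → V
  besides₁ zero    = 0F
  besides₁ (suc i) = suc (suc i)

  fanAdj : V → V → Bool
  fanAdj zero          zero          = false
  fanAdj zero          (suc _)       = true
  fanAdj (suc zero)    zero          = true
  fanAdj (suc zero)    (suc zero)    = false
  fanAdj (suc zero)    (suc (suc _)) = true
  fanAdj (suc (suc _)) zero          = true
  fanAdj (suc (suc _)) (suc zero)    = true
  fanAdj (suc (suc _)) (suc (suc _)) = false

  -- At 0 and 1 the outer corner is reflex. At any other vertex `v` it is the corner entered by the
  -- dart (1 , v): the outer one for the vertex 2, otherwise a corner of the quadrangle in which `v`
  -- follows its predecessor around 1. So each quadrangle has exactly one reflex corner, and the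
  -- interior triangle has none.
  fanReflex : V → V → Bool
  fanReflex zero          zero                = false
  fanReflex zero          (suc zero)          = false
  fanReflex zero          (suc (suc zero))    = true
  fanReflex zero          (suc (suc (suc _))) = false
  fanReflex (suc zero)    zero                = true
  fanReflex (suc zero)    (suc _)             = false
  fanReflex (suc (suc _)) zero                = false
  fanReflex (suc (suc _)) (suc zero)          = true
  fanReflex (suc (suc _)) (suc (suc _))       = false

  fanRot : (nxt prv : Fin (suc m) → Fin (suc m)) → V → V → V
  fanRot nxt prv zero          zero          = zero
  fanRot nxt prv zero          (suc z)       = suc (prv z)
  fanRot nxt prv (suc zero)    zero          = besides₁ (nxt zero)
  fanRot nxt prv (suc zero)    (suc zero)    = suc zero
  fanRot nxt prv (suc zero)    (suc (suc i)) = besides₁ (nxt (suc i))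
  fanRot nxt prv (suc (suc i)) zero          = suc zero
  fanRot nxt prv (suc (suc i)) (suc zero)    = zero
  fanRot nxt prv (suc (suc i)) (suc (suc j)) = suc (suc j)

  fan : (nxt prv : Fin (suc m) → Fin (suc m)) → PPT (suc (suc m))
  fan nxt prv = record { adj = fanAdj ; rot = fanRot nxt prv ; reflex = fanReflex }

  besides₁-injective : ∀ {x y} → besides₁ x ≡ besides₁ y → x ≡ y
  besides₁-injective {zero}  {zero}  eq   = refl
  besides₁-injective {suc _} {suc _} refl = refl

  adj-irrefl : ∀ u → fanAdj u u ≡ false
  adj-irrefl zero          = refl
  adj-irrefl (suc zero)    = refl
  adj-irrefl (suc (suc _)) = refl

  adj-sym : ∀ u v → fanAdj u v ≡ fanAdj v u
  adj-sym zero          zero          = refl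
  adj-sym zero          (suc zero)    = refl
  adj-sym zero          (suc (suc _)) = refl
  adj-sym (suc zero)    zero          = refl
  adj-sym (suc zero)    (suc zero)    = refl
  adj-sym (suc zero)    (suc (suc _)) = refl
  adj-sym (suc (suc _)) zero          = refl
  adj-sym (suc (suc _)) (suc zero)    = refl
  adj-sym (suc (suc _)) (suc (suc _)) = refl

  connected : Connected fanAdj
  connected u v = reach-trans (to₀ u) (from₀ v)
    where
    from₀ : ∀ v → Reach fanAdj 0F v
    from₀ zero    = here
    from₀ (suc _) = there refl here
    to₀ : ∀ u → Reach fanAdj u 0F
    to₀ zero          = here
    to₀ (suc zero)    = there refl here
    to₀ (suc (suc _)) = there refl here

  euler : 2 * suc (suc m) + 2 * suc m ≡ 4 + numDarts fanAdj
  euler = trans (eq m) (cong (4 +_) (sym darts))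
    where
    eq : ∀ m → 2 * suc (suc m) + 2 * suc m ≡ 4 + (suc m + (suc m + m * 2))
    eq = solve-∀
    ones : ∀ j → sumFin j (λ _ → 1) ≡ j
    ones j = trans (sumFin-const j 1) (*-identityʳ j)
    darts : numDarts fanAdj ≡ suc m + (suc m + m * 2)
    darts = cong₂ _+_ (ones (suc m)) (cong₂ _+_ (cong suc (ones m))
      (trans (sumFin-const m _)
             (cong (λ z → m * (2 + z)) (trans (sumFin-const m 0) (*-zeroʳ m)))))

  module Cyclic (nxt prv : Fin (suc m) → Fin (suc m))
    (nxt-prv : ∀ z → nxt (prv z) ≡ z) (prv-nxt : ∀ z → prv (nxt z) ≡ z)
    (nxt-zero : nxt zero ≡ suc zero) (orbit : ∀ x y → ∃ λ j → iter nxt j x ≡ y)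
    where

    private
      r : V → V → V
      r = fanRot nxt prv

    prv-one : prv (suc zero) ≡ zero
    prv-one = trans (cong prv (sym nxt-zero)) (prv-nxt zero)

    -- A fixed point would be a whole orbit, yet `nxt` moves `zero`. This keeps the two opposite
    -- vertices `v` and `w` of a quadrangle apart.
    nxt-fixfree : ∀ x → nxt x ≢ x
    nxt-fixfree x fix =
      let j , eq = orbit x zero
      in 1≢0 (trans (sym nxt-zero) (subst (λ z → nxt z ≡ z) (trans (sym (stuck j)) eq) fix))
      where
      1≢0 : suc zero ≢ zero {suc k}
      1≢0 ()
      stuck : ∀ j → iter nxt j x ≡ x
      stuck zero    = refl
      stuck (suc j) = trans (cong nxt (stuck j)) fix

    rot-besides₁ : ∀ x → r 1F (besides₁ x) ≡ besides₁ (nxt x)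
    rot-besides₁ zero    = refl
    rot-besides₁ (suc i) = refl

    rotationSystem : RotationSystem fanAdj r
    rotationSystem = stays , fixes , injective , cyclic
      where
      adj-besides₁ : ∀ x → fanAdj 1F (besides₁ x) ≡ true
      adj-besides₁ zero    = refl
      adj-besides₁ (suc _) = refl
      stays : ∀ v u → fanAdj v u ≡ true → fanAdj v (r v u) ≡ true
      stays zero          (suc z)       _ = refl
      stays (suc zero)    zero          _ = adj-besides₁ (nxt zero)
      stays (suc zero)    (suc (suc i)) _ = adj-besides₁ (nxt (suc i))
      stays (suc (suc i)) zero          _ = refl
      stays (suc (suc i)) (suc zero)    _ = refl
      fixes : ∀ v u → fanAdj v u ≡ false → r v u ≡ u
      fixes zero          zero          _ = refl
      fixes (suc zero)    (suc zero)    _ = refl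
      fixes (suc (suc i)) (suc (suc j)) _ = refl
      nxt-injective : ∀ {x y} → nxt x ≡ nxt y → x ≡ y
      nxt-injective {x} {y} eq = trans (sym (prv-nxt x)) (trans (cong prv eq) (prv-nxt y))
      index₁ : ∀ u → fanAdj 1F u ≡ true → ∃ λ x → u ≡ besides₁ x
      index₁ zero          _ = zero , refl
      index₁ (suc (suc i)) _ = suc i , refl
      injective : ∀ v u w → fanAdj v u ≡ true → fanAdj v w ≡ true → r v u ≡ r v w → u ≡ w
      injective zero (suc y) (suc z) _ _ eq =
        cong suc (trans (sym (nxt-prv y)) (trans (cong nxt (suc-injective eq)) (nxt-prv z)))
      injective (suc zero) u w p q eq with index₁ u p | index₁ w q
      ... | x , refl | y , refl =
        cong besides₁ (nxt-injective (besides₁-injective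
          (trans (sym (rot-besides₁ x)) (trans eq (rot-besides₁ y)))))
      injective (suc (suc i)) zero       zero       _ _ _ = refl
      injective (suc (suc i)) zero       (suc (suc _)) _ ()
      injective (suc (suc i)) (suc zero) (suc zero) _ _ _ = refl
      cyclic : ∀ v u w → fanAdj v u ≡ true → fanAdj v w ≡ true → ∃ λ j → iter (r v) j u ≡ w
      cyclic zero (suc y) (suc z) _ _ =
        let j , eq = orbit z y in
        j , trans (iter-conj suc (λ _ → refl) j y)
                  (cong suc (trans (cong (iter prv j) (sym eq)) (iter-inverse prv-nxt j z)))
      cyclic (suc zero) u w p q with index₁ u p | index₁ w q
      ... | x , refl | y , refl =
        let j , eq = orbit x y in
        j , trans (iter-conj besides₁ rot-besides₁ j x) (cong besides₁ eq)
      cyclic (suc (suc i)) zero       zero       _ _ = 0 , refl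
      cyclic (suc (suc i)) zero       (suc zero) _ _ = 1 , refl
      cyclic (suc (suc i)) (suc zero) zero       _ _ = 1 , refl
      cyclic (suc (suc i)) (suc zero) (suc zero) _ _ = 0 , refl

    entering₁ : Fin (suc m) → Dart (suc (suc m))
    entering₁ x = besides₁ x , 1F

    -- A face is named by its dart entering vertex 1.
    face : Dart (suc (suc m)) → Fin (suc m)
    face (zero        , zero)        = zero
    face (zero        , suc z)       = z
    face (suc zero    , zero)        = prv zero
    face (suc zero    , suc zero)    = zero
    face (suc zero    , suc (suc i)) = prv (suc i)
    face (suc (suc i) , zero)        = prv (suc i)
    face (suc (suc i) , suc zero)    = suc i
    face (suc (suc i) , suc (suc j)) = zero

    face-leaving₁ : ∀ x → face (1F , besides₁ x) ≡ prv x
    face-leaving₁ zero    = refl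
    face-leaving₁ (suc i) = refl

    face-step-invariant : ∀ d → IsDart fanAdj d → face (step r d) ≡ face d
    face-step-invariant (zero        , suc zero)    _ =
      trans (face-leaving₁ (nxt zero)) (prv-nxt zero)
    face-step-invariant (zero        , suc (suc i)) _ = refl
    face-step-invariant (suc zero    , zero)        _ = refl
    face-step-invariant (suc zero    , suc (suc i)) _ = refl
    face-step-invariant (suc (suc i) , zero)        _ = refl
    face-step-invariant (suc (suc i) , suc zero)    _ =
      trans (face-leaving₁ (nxt (suc i))) (prv-nxt (suc i))

    dart-step : ∀ d → IsDart fanAdj d → IsDart fanAdj (step r d)
    dart-step (u , v) dart = proj₁ rotationSystem v u (trans (adj-sym v u) dart)

    sameFace⇒face : ∀ {d d′} → IsDart fanAdj d → SameFace r d d′ → face d ≡ face d′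
    sameFace⇒face {d} dart (j , refl) = sym (proj₂ (go j))
      where
      go : ∀ j → IsDart fanAdj (iter (step r) j d) × face (iter (step r) j d) ≡ face d
      go zero    = dart , refl
      go (suc j) = let dart′ , eq = go j in
        dart-step (iter (step r) j d) dart′ ,
        trans (face-step-invariant (iter (step r) j d) dart′) eq

    leaving₀ : ∀ z → SameFace r (0F , suc z) (entering₁ z)
    leaving₀ zero    = 0 , refl
    leaving₀ (suc i) = 1 , refl

    to-entering₁ : ∀ d → IsDart fanAdj d → SameFace r d (entering₁ (face d))
    to-entering₁ (zero , suc z)              _ = leaving₀ z
    to-entering₁ (suc zero , zero)           _ = face-step (leaving₀ (prv zero))
    to-entering₁ (suc zero , suc (suc i))    _ = face-step (face-step (leaving₀ (prv (suc i))))
    to-entering₁ (suc (suc i) , zero)        _ = face-step (leaving₀ (prv (suc i)))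
    to-entering₁ (suc (suc i) , suc zero)    _ = 0 , refl

    step-entering₁ : ∀ x → step r (entering₁ x) ≡ (1F , besides₁ (nxt x))
    step-entering₁ x = cong (1F ,_) (rot-besides₁ x)

    leaving₁ : ∀ x → SameFace r (entering₁ (prv x)) (1F , besides₁ x)
    leaving₁ x = 1 , trans (step-entering₁ (prv x)) (cong (λ y → 1F , besides₁ y) (nxt-prv x))

    from-entering₁ : ∀ d → IsDart fanAdj d → SameFace r (entering₁ (face d)) d
    from-entering₁ (zero , suc z)              _ = go (nxt z) (prv-nxt z)
      where
      go : ∀ y → prv y ≡ z → SameFace r (entering₁ z) (0F , suc z)
      go zero    refl = step-face (leaving₁ zero)
      go (suc j) refl = step-face (step-face (leaving₁ (suc j)))
    from-entering₁ (suc zero , zero)           _ = leaving₁ zero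
    from-entering₁ (suc zero , suc (suc i))    _ = leaving₁ (suc i)
    from-entering₁ (suc (suc i) , zero)        _ = step-face (leaving₁ (suc i))
    from-entering₁ (suc (suc i) , suc zero)    _ = 0 , refl

    planar : Planar fanAdj r
    planar = connected , suc m , (face , faces≡ , surjective) , euler
      where
      faces≡ : ∀ d d′ → IsDart fanAdj d → IsDart fanAdj d′ →
               (face d ≡ face d′ → SameFace r d d′) × (SameFace r d d′ → face d ≡ face d′)
      faces≡ d d′ dart dart′ =
        (λ eq → face-trans (subst (SameFace r d ∘ entering₁) eq (to-entering₁ d dart))
                           (from-entering₁ d′ dart′)) ,
        sameFace⇒face dart
      surjective : ∀ x → ∃ λ d → IsDart fanAdj d × face d ≡ x
      surjective zero    = entering₁ zero , refl , refl
      surjective (suc i) = entering₁ (suc i) , refl , refl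

    Interior : Dart (suc (suc m)) → Set
    Interior d = ∃ λ j → (j ≡ 3 ⊎ j ≡ 4) × SimpleCycleFace r d j ×
      countBelow j (λ i → let e = iter (step r) i d in not (fanReflex (proj₂ e) (proj₁ e))) ≡ 3

    corners : Dart (suc (suc m)) → ℕ
    corners (u , v) = if not (fanReflex v u) then 1 else 0

    triangle : ∀ {d₀ d₁ d₂} → step r d₀ ≡ d₁ → step r d₁ ≡ d₂ → step r d₂ ≡ d₀ →
      proj₁ d₀ ≢ proj₁ d₁ → proj₁ d₀ ≢ proj₁ d₂ → proj₁ d₁ ≢ proj₁ d₂ →
      corners d₀ + corners d₁ + corners d₂ ≡ 3 → Interior d₀
    triangle {d₀} refl refl closed 0≢1 0≢2 1≢2 count =
      3 , inj₁ refl , (closed , distinct₃ (λ i → proj₁ (iter (step r) i d₀)) 0≢1 0≢2 1≢2) , count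

    quadrangle : ∀ {d₀ d₁ d₂ d₃} → step r d₀ ≡ d₁ → step r d₁ ≡ d₂ → step r d₂ ≡ d₃ → step r d₃ ≡ d₀ →
      proj₁ d₀ ≢ proj₁ d₁ → proj₁ d₀ ≢ proj₁ d₂ → proj₁ d₀ ≢ proj₁ d₃ →
      proj₁ d₁ ≢ proj₁ d₂ → proj₁ d₁ ≢ proj₁ d₃ → proj₁ d₂ ≢ proj₁ d₃ →
      corners d₀ + corners d₁ + corners d₂ + corners d₃ ≡ 3 → Interior d₀
    quadrangle {d₀} refl refl refl closed 0≢1 0≢2 0≢3 1≢2 1≢3 2≢3 count =
      4 , inj₂ refl ,
      (closed , distinct₄ (λ i → proj₁ (iter (step r) i d₀)) 0≢1 0≢2 0≢3 1≢2 1≢3 2≢3) , count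

    -- The last neighbour of 1 before the cyclic order returns to 0 bounds, with the edge {0 , 1},
    -- the only interior triangle; all other interior faces are quadrangles.
    module LastFace (i : Fin m) (last : nxt (suc i) ≡ zero) where

      private
        v : V
        v = suc (suc i)
        s₁ : step r (v , 1F) ≡ (1F , 0F)
        s₁ = cong (λ z → 1F , besides₁ z) last
        s₂ : step r (1F , 0F) ≡ (0F , v)
        s₂ = cong (λ z → 0F , suc z) (trans (cong prv (sym last)) (prv-nxt (suc i)))

      in-v1 : Interior (v , 1F)
      in-v1 = triangle s₁ s₂ refl (λ ()) (λ ()) (λ ()) refl

      in-10 : Interior (1F , 0F)
      in-10 = triangle s₂ refl s₁ (λ ()) (λ ()) (λ ()) refl

      in-0v : Interior (0F , v)
      in-0v = triangle refl s₁ s₂ (λ ()) (λ ()) (λ ()) refl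

    module MiddleFace (i j : Fin m) (nxt≡ : nxt (suc i) ≡ suc j) where

      private
        v w : V
        v = suc (suc i)
        w = suc (suc j)
        prv≡ : prv (suc j) ≡ suc i
        prv≡ = trans (cong prv (sym nxt≡)) (prv-nxt (suc i))
        s₁ : step r (v , 1F) ≡ (1F , w)
        s₁ = cong (λ z → 1F , besides₁ z) nxt≡
        s₂ : step r (w , 0F) ≡ (0F , v)
        s₂ = cong (λ z → 0F , suc z) prv≡
        v≢w : v ≢ w
        v≢w eq = nxt-fixfree (suc i) (trans nxt≡ (sym (suc-injective eq)))
        -- The reflex corner at 0 is the one entered from the vertex 2. That vertex comes right
        -- after 0 around 1, so it is never the later vertex `w` of a quadrangle.
        convex′ : ∀ j → prv (suc j) ≡ suc i → corners (suc (suc j) , 0F) ≡ 1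
        convex′ zero    eq with trans (sym eq) prv-one
        ... | ()
        convex′ (suc _) _ = refl
        convex : corners (w , 0F) ≡ 1
        convex = convex′ j prv≡

      in-v1 : Interior (v , 1F)
      in-v1 = quadrangle s₁ refl s₂ refl (λ ()) v≢w (λ ()) (λ ()) (λ ()) (λ ())
                (cong (λ c → 1 + c + 1) convex)

      in-1w : Interior (1F , w)
      in-1w = quadrangle refl s₂ refl s₁ (λ ()) (λ ()) (λ ()) (λ ()) (v≢w ∘ sym) (λ ())
                (cong (λ c → c + 1 + 1) convex)

      in-w0 : Interior (w , 0F)
      in-w0 = quadrangle s₂ refl s₁ refl (λ ()) (v≢w ∘ sym) (λ ()) (λ ()) (λ ()) (λ ())
                (cong (λ c → c + 1 + 1 + 0) convex)

      in-0v : Interior (0F , v)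
      in-0v = quadrangle refl s₁ refl s₂ (λ ()) (λ ()) (λ ()) (λ ()) v≢w (λ ())
                (cong (λ c → 2 + c) convex)

    data Outer : Dart (suc (suc m)) → Set where
      out-01 : Outer (0F , 1F)
      out-12 : Outer (1F , 2F)
      out-20 : Outer (2F , 0F)

    outer-step : ∀ {d} → Outer d → Outer (step r d)
    outer-step out-01 = subst (λ z → Outer (1F , besides₁ z)) (sym nxt-zero) out-12
    outer-step out-12 = out-20
    outer-step out-20 = subst (λ z → Outer (0F , suc z)) (sym prv-one) out-01

    outer : ∀ {d} → SameFace r (0F , 1F) d → Outer d
    outer (j , refl) = go j
      where
      go : ∀ j → Outer (iter (step r) j (0F , 1F))
      go zero    = out-01
      go (suc j) = outer-step (go j)

    outer-12 : SameFace r (0F , 1F) (1F , 2F)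
    outer-12 = 1 , cong (λ z → 1F , besides₁ z) nxt-zero

    interior : ∀ d → IsDart fanAdj d → ¬ SameFace r (0F , 1F) d → Interior d
    interior (zero , suc zero) _ ¬out = ⊥-elim (¬out (0 , refl))
    interior (zero , suc (suc i)) _ _ with nxt (suc i) in eq
    ... | zero  = LastFace.in-0v i eq
    ... | suc j = MiddleFace.in-0v i j eq
    interior (suc (suc i) , suc zero) _ _ with nxt (suc i) in eq
    ... | zero  = LastFace.in-v1 i eq
    ... | suc j = MiddleFace.in-v1 i j eq
    interior (suc zero , zero) _ _ with prv zero in eq
    ... | suc i = LastFace.in-10 i (trans (cong nxt (sym eq)) (nxt-prv zero))
    ... | zero with trans (sym nxt-zero) (trans (cong nxt (sym eq)) (nxt-prv zero))
    ... | ()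
    interior (suc zero , suc (suc j)) _ ¬out with prv (suc j) in eq
    ... | suc i = MiddleFace.in-1w i j (trans (cong nxt (sym eq)) (nxt-prv (suc j)))
    ... | zero with trans (sym nxt-zero) (trans (cong nxt (sym eq)) (nxt-prv (suc j)))
    ... | refl = ⊥-elim (¬out outer-12)
    interior (suc (suc j) , zero) _ ¬out with prv (suc j) in eq
    ... | suc i = MiddleFace.in-w0 i j (trans (cong nxt (sym eq)) (nxt-prv (suc j)))
    ... | zero with trans (sym nxt-zero) (trans (cong nxt (sym eq)) (nxt-prv (suc j)))
    ... | refl = ⊥-elim (¬out (step-face outer-12))

    is4PPT : Is4PPT 0F 1F 2F (fan nxt prv)
    is4PPT = (adj-irrefl , adj-sym) , rotationSystem , planar , untagged ,
      (λ ()) , (λ ()) , (λ ()) , refl ,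
      cong (λ z → 1F , besides₁ z) nxt-zero , refl , cong (λ z → 0F , suc z) prv-one ,
      interior , outer-reflex , pointed
      where
      untagged : ∀ v u → fanAdj v u ≡ false → fanReflex v u ≡ false
      untagged zero          zero          _ = refl
      untagged (suc zero)    (suc zero)    _ = refl
      untagged (suc (suc _)) (suc (suc _)) _ = refl
      outer-reflex : ∀ d → SameFace r (0F , 1F) d → fanReflex (proj₂ d) (proj₁ d) ≡ true
      outer-reflex d out with outer out
      ... | out-01 = refl
      ... | out-12 = refl
      ... | out-20 = refl
      pointed : ∀ v → ∃ λ u → fanAdj v u ≡ true × fanReflex v u ≡ true ×
                (∀ w → fanAdj v w ≡ true → fanReflex v w ≡ true → w ≡ u)
      pointed zero          = 2F , refl , refl , λ { (suc (suc zero)) _ _ → refl }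
      pointed (suc zero)    = 0F , refl , refl , λ { zero _ _ → refl }
      pointed (suc (suc _)) = 1F , refl , refl , λ { (suc zero) _ _ → refl }

  -- Numbering the darts of the fan by slots.

  #slots : ℕ
  #slots = (suc m + suc m) + (m + m)

  private
    Kind : Set
    Kind = (Fin (suc m) ⊎ Fin (suc m)) ⊎ (Fin m ⊎ Fin m)

    kindDart : Kind → Dart (suc (suc m))
    kindDart (inj₁ (inj₁ x)) = besides₁ x , 1F
    kindDart (inj₁ (inj₂ x)) = 1F , besides₁ x
    kindDart (inj₂ (inj₁ i)) = 0F , suc (suc i)
    kindDart (inj₂ (inj₂ i)) = suc (suc i) , 0F

    dartKind : Dart (suc (suc m)) → Kind
    dartKind (zero        , zero)        = inj₁ (inj₁ zero)
    dartKind (zero        , suc zero)    = inj₁ (inj₁ zero)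
    dartKind (zero        , suc (suc i)) = inj₂ (inj₁ i)
    dartKind (suc zero    , zero)        = inj₁ (inj₂ zero)
    dartKind (suc zero    , suc zero)    = inj₁ (inj₁ zero)
    dartKind (suc zero    , suc (suc i)) = inj₁ (inj₂ (suc i))
    dartKind (suc (suc i) , zero)        = inj₂ (inj₂ i)
    dartKind (suc (suc i) , suc zero)    = inj₁ (inj₁ (suc i))
    dartKind (suc (suc i) , suc (suc j)) = inj₁ (inj₁ zero)

    kindDart-dart : ∀ c → IsDart fanAdj (kindDart c)
    kindDart-dart (inj₁ (inj₁ zero))    = refl
    kindDart-dart (inj₁ (inj₁ (suc i))) = refl
    kindDart-dart (inj₁ (inj₂ zero))    = refl
    kindDart-dart (inj₁ (inj₂ (suc i))) = refl
    kindDart-dart (inj₂ (inj₁ i))       = refl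
    kindDart-dart (inj₂ (inj₂ i))       = refl

    dartKind-kindDart : ∀ c → dartKind (kindDart c) ≡ c
    dartKind-kindDart (inj₁ (inj₁ zero))    = refl
    dartKind-kindDart (inj₁ (inj₁ (suc i))) = refl
    dartKind-kindDart (inj₁ (inj₂ zero))    = refl
    dartKind-kindDart (inj₁ (inj₂ (suc i))) = refl
    dartKind-kindDart (inj₂ (inj₁ i))       = refl
    dartKind-kindDart (inj₂ (inj₂ i))       = refl

    kindDart-dartKind : ∀ d → IsDart fanAdj d → kindDart (dartKind d) ≡ d
    kindDart-dartKind (zero        , suc zero)    _ = refl
    kindDart-dartKind (zero        , suc (suc i)) _ = refl
    kindDart-dartKind (suc zero    , zero)        _ = refl
    kindDart-dartKind (suc zero    , suc (suc i)) _ = refl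
    kindDart-dartKind (suc (suc i) , zero)        _ = refl
    kindDart-dartKind (suc (suc i) , suc zero)    _ = refl

    slotKind : Fin #slots → Kind
    slotKind s = map-⊎ (splitAt (suc m)) (splitAt m) (splitAt (suc m + suc m) s)

    kindSlot : Kind → Fin #slots
    kindSlot c = join (suc m + suc m) (m + m) (map-⊎ (join (suc m) (suc m)) (join m m) c)

    slotKind-kindSlot : ∀ c → slotKind (kindSlot c) ≡ c
    slotKind-kindSlot c
      rewrite splitAt-join (suc m + suc m) (m + m) (map-⊎ (join (suc m) (suc m)) (join m m) c)
      with c
    ... | inj₁ c′ = cong inj₁ (splitAt-join (suc m) (suc m) c′)
    ... | inj₂ c′ = cong inj₂ (splitAt-join m m c′)

    kindSlot-slotKind : ∀ s → kindSlot (slotKind s) ≡ s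
    kindSlot-slotKind s = trans (cong (join (suc m + suc m) (m + m)) (inner (splitAt (suc m + suc m) s)))
                                (join-splitAt (suc m + suc m) (m + m) s)
      where
      inner : ∀ c → map-⊎ (join (suc m) (suc m)) (join m m)
                      (map-⊎ (splitAt (suc m)) (splitAt m) c) ≡ c
      inner (inj₁ x) = cong inj₁ (join-splitAt (suc m) (suc m) x)
      inner (inj₂ x) = cong inj₂ (join-splitAt m m x)

  slotDart : Fin #slots → Dart (suc (suc m))
  slotDart = kindDart ∘ slotKind

  dartSlot : Dart (suc (suc m)) → Fin #slots
  dartSlot = kindSlot ∘ dartKind

  slotDart-dart : ∀ s → IsDart fanAdj (slotDart s)
  slotDart-dart s = kindDart-dart (slotKind s)

  dartSlot-slotDart : ∀ s → dartSlot (slotDart s) ≡ s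
  dartSlot-slotDart s =
    trans (cong kindSlot (dartKind-kindDart (slotKind s))) (kindSlot-slotKind s)

  slotDart-dartSlot : ∀ {d} → IsDart fanAdj d → slotDart (dartSlot d) ≡ d
  slotDart-dartSlot {d} dart =
    trans (cong kindDart (slotKind-kindSlot (dartKind d))) (kindDart-dartKind d dart)

  -- Reversal in the initial fan; since flips reuse slots in pairs, it remains the reversal in every
  -- graph reached from there.
  twin : Fin #slots → Fin #slots
  twin s = dartSlot (swap (slotDart s))

  module _ (nxt prv : Fin (suc m) → Fin (suc m)) where

    initial : State #slots (suc (suc m))
    initial s = dartSlot (step (fanRot nxt prv) (slotDart s)) , slotDart s

    initial-represents : RotationSystem fanAdj (fanRot nxt prv) →
                         Represents twin (fan nxt prv) initial
    initial-represents (stays , _) = record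
      { loc       = dartSlot
      ; ends-dart = slotDart-dart
      ; loc-ends  = dartSlot-slotDart
      ; ends-loc  = slotDart-dartSlot
      ; ends-tw   = λ s → slotDart-dartSlot (dart-swap (slotDart-dart s))
      ; ends-next = λ s → slotDart-dartSlot (dart-step (slotDart-dart s))
      }
      where
      dart-swap : ∀ {d} → IsDart fanAdj d → IsDart fanAdj (swap d)
      dart-swap {u , v} dart = trans (adj-sym v u) dart
      dart-step : ∀ {d} → IsDart fanAdj d → IsDart fanAdj (step (fanRot nxt prv) d)
      dart-step {u , v} dart = stays v u (trans (adj-sym v u) dart)

-- Cyclic orders from permutations.

rotate : ∀ {N} → Fin (suc N) → Fin (suc N)
rotate i with view i
... | ‵fromℕ     = zero
... | ‵inject₁ j = suc j

unrotate : ∀ {N} → Fin (suc N) → Fin (suc N)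
unrotate zero    = fromℕ _
unrotate (suc j) = inject₁ j

rotate-fromℕ : ∀ N → rotate (fromℕ N) ≡ zero
rotate-fromℕ N rewrite view-fromℕ N = refl

rotate-inject₁ : ∀ {N} (j : Fin N) → rotate (inject₁ j) ≡ suc j
rotate-inject₁ j rewrite view-inject₁ j = refl

rotate-unrotate : ∀ {N} (i : Fin (suc N)) → rotate (unrotate i) ≡ i
rotate-unrotate zero    = rotate-fromℕ _
rotate-unrotate (suc j) = rotate-inject₁ j

unrotate-rotate : ∀ {N} (i : Fin (suc N)) → unrotate (rotate i) ≡ i
unrotate-rotate i with view i
... | ‵fromℕ     = refl
... | ‵inject₁ j = refl

rotate-orbit : ∀ {N} (x y : Fin (suc N)) → ∃ λ j → iter rotate j x ≡ y
rotate-orbit x y =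
  let i , p = to-zero x
      j , q = from-zero y
  in j + i , trans (sym (iter-+ rotate j i x)) (trans (cong (iter rotate j) p) q)
  where
  from-zero : ∀ {N} (y : Fin (suc N)) → ∃ λ j → iter rotate j zero ≡ y
  from-zero = <-weakInduction _ (0 , refl)
    (λ i (j , eq) → suc j , trans (cong rotate eq) (rotate-inject₁ i))
  to-zero : ∀ {N} (x : Fin (suc N)) → ∃ λ j → iter rotate j x ≡ zero
  to-zero = >-weakInduction _ (1 , rotate-fromℕ _)
    (λ i (j , eq) → suc j ,
       trans (sym (iter-shift rotate j (inject₁ i))) (trans (cong (iter rotate j) (rotate-inject₁ i)) eq))

-- The factorial number system: the leading digit is the image of `zero`, the other digits encode
-- the permutation of what remains.
decodePermutation : ∀ k → Fin (k !) → Permutation′ k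
decodePermutation zero    c = idₚ
decodePermutation (suc k) c =
  insert zero (proj₁ (remQuot {suc k} (k !) c)) (decodePermutation k (proj₂ (remQuot {suc k} (k !) c)))

decodePermutation-injective : ∀ k c c′ →
  (∀ i → decodePermutation k c ⟨$⟩ʳ i ≡ decodePermutation k c′ ⟨$⟩ʳ i) → c ≡ c′
decodePermutation-injective zero    zero zero _  = refl
decodePermutation-injective (suc k) c    c′   eq = begin
  c                        ≡⟨ combine-remQuot {suc k} (k !) c ⟨
  uncurry combine (i , d)  ≡⟨ cong₂ combine (eq zero) d≡d′ ⟩
  uncurry combine (i′ , d′) ≡⟨ combine-remQuot {suc k} (k !) c′ ⟩
  c′ ∎
  where
  open ≡-Reasoning
  i i′ : Fin (suc k)
  i = proj₁ (remQuot {suc k} (k !) c)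
  i′ = proj₁ (remQuot {suc k} (k !) c′)
  d d′ : Fin (k !)
  d = proj₂ (remQuot {suc k} (k !) c)
  d′ = proj₂ (remQuot {suc k} (k !) c′)
  d≡d′ : d ≡ d′
  d≡d′ = decodePermutation-injective k d d′ λ j → punchIn-injective i _ _ (begin
    _ ≡⟨ insert-punchIn zero i (decodePermutation k d) j ⟨
    decodePermutation (suc k) c ⟨$⟩ʳ suc j ≡⟨ eq (suc j) ⟩
    decodePermutation (suc k) c′ ⟨$⟩ʳ suc j ≡⟨ insert-punchIn zero i′ (decodePermutation k d′) j ⟩
    _ ≡⟨ cong (λ i → punchIn i (decodePermutation k d′ ⟨$⟩ʳ j)) (eq zero) ⟨
    _ ∎)

-- The cyclic shift is conjugated by a permutation `π` that fixes the first two positions. This puts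
-- the vertex 2 right after 0 around 1, so that all these fans share the labelled outer face.
module Ordered {k : ℕ} (ρ : Permutation′ k) where

  private
    π : Permutation′ (suc (suc k))
    π = lift₀ (lift₀ ρ)

  nxt prv : Fin (suc (suc k)) → Fin (suc (suc k))
  nxt z = π ⟨$⟩ʳ rotate (π ⟨$⟩ˡ z)
  prv z = π ⟨$⟩ʳ unrotate (π ⟨$⟩ˡ z)

  nxt-prv : ∀ z → nxt (prv z) ≡ z
  nxt-prv z = trans (cong (λ i → π ⟨$⟩ʳ rotate i) (inverseˡ π {unrotate (π ⟨$⟩ˡ z)}))
                    (trans (cong (π ⟨$⟩ʳ_) (rotate-unrotate (π ⟨$⟩ˡ z))) (inverseʳ π))

  prv-nxt : ∀ z → prv (nxt z) ≡ z
  prv-nxt z = trans (cong (λ i → π ⟨$⟩ʳ unrotate i) (inverseˡ π {rotate (π ⟨$⟩ˡ z)}))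
                    (trans (cong (π ⟨$⟩ʳ_) (unrotate-rotate (π ⟨$⟩ˡ z))) (inverseʳ π))

  nxt-π : ∀ i → nxt (π ⟨$⟩ʳ i) ≡ π ⟨$⟩ʳ rotate i
  nxt-π i = cong (λ j → π ⟨$⟩ʳ rotate j) (inverseˡ π {i})

  orbit : ∀ x y → ∃ λ j → iter nxt j x ≡ y
  orbit x y =
    let j , eq = rotate-orbit (π ⟨$⟩ˡ x) (π ⟨$⟩ˡ y)
    in j , (begin
      iter nxt j x                    ≡⟨ cong (iter nxt j) (inverseʳ π) ⟨
      iter nxt j (π ⟨$⟩ʳ (π ⟨$⟩ˡ x))    ≡⟨ iter-conj (π ⟨$⟩ʳ_) nxt-π j (π ⟨$⟩ˡ x) ⟩
      π ⟨$⟩ʳ iter rotate j (π ⟨$⟩ˡ x)   ≡⟨ cong (π ⟨$⟩ʳ_) eq ⟩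
      π ⟨$⟩ʳ (π ⟨$⟩ˡ y)                ≡⟨ inverseʳ π ⟩
      y ∎)
    where open ≡-Reasoning

  nxt-zero : nxt zero ≡ suc zero
  nxt-zero = cong (π ⟨$⟩ʳ_) (rotate-inject₁ zero)

  open Fan.Cyclic {k} nxt prv nxt-prv prv-nxt nxt-zero orbit public using (is4PPT; rotationSystem)

  orderedFan : PPT (3 + k)
  orderedFan = Fan.fan nxt prv

-- A cyclic order determines the conjugating permutation only up to a rotation. Fixing the image of
-- `zero` removes this freedom, and walking along the order from `zero` recovers all other images.
nxt-injective : ∀ {k} (ρ ρ′ : Permutation′ k) → Ordered.nxt ρ ≗ Ordered.nxt ρ′ →
                ∀ i → ρ ⟨$⟩ʳ i ≡ ρ′ ⟨$⟩ʳ i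
nxt-injective ρ ρ′ eq i = suc-injective (suc-injective (same (suc (suc i))))
  where
  open ≡-Reasoning
  same : ∀ j → lift₀ (lift₀ ρ) ⟨$⟩ʳ j ≡ lift₀ (lift₀ ρ′) ⟨$⟩ʳ j
  same = <-weakInduction _ refl λ j ih → begin
    lift₀ (lift₀ ρ) ⟨$⟩ʳ suc j ≡⟨ cong (lift₀ (lift₀ ρ) ⟨$⟩ʳ_) (rotate-inject₁ j) ⟨
    lift₀ (lift₀ ρ) ⟨$⟩ʳ rotate (inject₁ j) ≡⟨ Ordered.nxt-π ρ (inject₁ j) ⟨
    Ordered.nxt ρ (lift₀ (lift₀ ρ) ⟨$⟩ʳ inject₁ j) ≡⟨ eq _ ⟩
    Ordered.nxt ρ′ (lift₀ (lift₀ ρ) ⟨$⟩ʳ inject₁ j) ≡⟨ cong (Ordered.nxt ρ′) ih ⟩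
    Ordered.nxt ρ′ (lift₀ (lift₀ ρ′) ⟨$⟩ʳ inject₁ j) ≡⟨ Ordered.nxt-π ρ′ (inject₁ j) ⟩
    lift₀ (lift₀ ρ′) ⟨$⟩ʳ rotate (inject₁ j) ≡⟨ cong (lift₀ (lift₀ ρ′) ⟨$⟩ʳ_) (rotate-inject₁ j) ⟩
    lift₀ (lift₀ ρ′) ⟨$⟩ʳ suc j ∎

-- Counting codes against permutations.

-- If each `i` were related to some `x`, choosing one would be an injection from `Fin a` to `Fin b`,
-- against the pigeonhole principle.
avoid : ∀ {a b} (R : Fin a → Fin b → Set) → (∀ i x → Dec (R i x)) →
        (∀ {i j x} → R i x → R j x → i ≡ j) → b < a → ∃ λ i → ∀ x → ¬ R i x
avoid {a} R R? functional b<a with all? (λ i → any? (R? i))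
... | no ¬all =
  let i , none = ¬∀⟶∃¬ a _ (λ i → any? (R? i)) ¬all in i , λ x Rix → none (x , Rix)
... | yes all =
  let i , j , i<j , eq = pigeonhole b<a (proj₁ ∘ all)
  in ⊥-elim (<⇒≢ᶠ i<j (functional (proj₂ (all i)) (subst (R j) (sym eq) (proj₂ (all j)))))

module Counting (k : ℕ) where
  open Fan {k}
  open Machine {#slots} {3 + k} twin

  -- The state records the cyclic order nxt around vertex 1.
  Reads : State #slots (3 + k) → (Fin (suc (suc k)) → Fin (suc (suc k))) → Set
  Reads σ nxt =
    (∀ s x → ends σ s ≡ (besides₁ x , 1F) → ends σ (succ σ s) ≡ (1F , besides₁ (nxt x))) ×
    (∀ x → ∃ λ s → ends σ s ≡ (besides₁ x , 1F))

  reads? : ∀ σ nxt → Dec (Reads σ nxt)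
  reads? σ nxt =
    all? (λ s → all? (λ x → (ends σ s ≟ᵈ _) →-dec (ends σ (succ σ s) ≟ᵈ _))) ×-dec
    all? (λ x → any? (λ s → ends σ s ≟ᵈ _))
    where
    _≟ᵈ_ : (d d′ : Dart (3 + k)) → Dec (d ≡ d′)
    _≟ᵈ_ = ≡-dec _≟_ _≟_

  -- Codes that come from no flip path also decode to some state. This lemma charges even such a
  -- state with at most one order; the second half of `Reads` rules out states satisfying the first
  -- half vacuously.
  reads-functional : ∀ {σ nxt nxt′} → Reads σ nxt → Reads σ nxt′ → nxt ≗ nxt′
  reads-functional (next≡ , found) (next≡′ , _) x =
    let s , eq = found x
    in besides₁-injective (cong proj₂ (trans (sym (next≡ s x eq)) (next≡′ s x eq)))

  represents⇒reads : ∀ {σ σ′ T nxt prv} → Represents twin T σ → SamePPT T (fan nxt prv) →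
                     σ′ ≗ σ → Reads σ′ nxt
  represents⇒reads {σ} {σ′} {T} {nxt} {prv} rep same σ≗ = next≡ , found
    where
    open Represents rep
    open ≡-Reasoning
    ends≡ : ∀ s → ends σ′ s ≡ ends σ s
    ends≡ s = cong proj₂ (σ≗ s)
    rot-besides : ∀ x → rot T 1F (besides₁ x) ≡ besides₁ (nxt x)
    rot-besides zero    = proj₁ (proj₂ (same 1F 0F))
    rot-besides (suc i) = proj₁ (proj₂ (same 1F (suc (suc i))))
    dart : ∀ x → IsDart (adj T) (besides₁ x , 1F)
    dart zero    = proj₁ (same 0F 1F)
    dart (suc i) = proj₁ (same (suc (suc i)) 1F)
    next≡ : ∀ s x → ends σ′ s ≡ (besides₁ x , 1F) → ends σ′ (succ σ′ s) ≡ (1F , besides₁ (nxt x))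
    next≡ s x eq = begin
      ends σ′ (succ σ′ s)         ≡⟨ ends≡ (succ σ′ s) ⟩
      ends σ (succ σ′ s)          ≡⟨ cong (ends σ ∘ proj₁) (σ≗ s) ⟩
      ends σ (succ σ s)           ≡⟨ ends-next s ⟩
      step (rot T) (ends σ s)     ≡⟨ cong (step (rot T)) (trans (sym (ends≡ s)) eq) ⟩
      (1F , rot T 1F (besides₁ x)) ≡⟨ cong (1F ,_) (rot-besides x) ⟩
      (1F , besides₁ (nxt x)) ∎
    found : ∀ x → ∃ λ s → ends σ′ s ≡ (besides₁ x , 1F)
    found x = loc _ , trans (ends≡ _) (ends-loc (dart x))

  T₁ : PPT (3 + k)
  T₁ = Ordered.orderedFan idₚ

  private
    start : State #slots (3 + k)
    start = initial (Ordered.nxt idₚ) (Ordered.prv idₚ)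

  #codes : ℕ → ℕ
  #codes K = #labels ^ #slots * #relabellings ^ K

  reached : ∀ K → Fin (#codes K) → State #slots (3 + k)
  reached K c = let ℓ , ws = remQuot {#labels ^ #slots} (#relabellings ^ K) c
                in decode K start (finToFun ℓ) ws

  reached-complete : ∀ K {a b c nxt prv j} → j ≤ K → FlipPath a b c T₁ (fan nxt prv) j →
                     ∃ λ code → Reads (reached K code) nxt
  reached-complete K j≤K path =
    let σ∞ , T∞ , rep , same , ℓ , run =
          flips⇒run twin (initial-represents _ _ (Ordered.rotationSystem idₚ)) path
        ws , eq = decode-complete K j≤K
                    (run-cong (λ _ → refl) (finToFun-funToFin ℓ) run)
    in combine (funToFin ℓ) ws , represents⇒reads rep same λ s →
       trans (cong (λ p → decode K start (finToFun (proj₁ p)) (proj₂ p) s)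
                   (remQuot-combine (funToFin ℓ) ws)) (eq s)

  -- Each order within `K` flips of `T₁` is read off the result of some code. With fewer codes than
  -- permutations, some order is read off none.
  far : ∀ K → #codes K < k ! → ∃ λ ρ → ∀ {a b c j} →
        FlipPath a b c T₁ (Ordered.orderedFan {k} ρ) j → K < j
  far K few =
    let c , missed = avoid (λ c code → Reads (reached K code) (order c))
                           (λ c code → reads? (reached K code) (order c))
                           (λ {c} {c′} p q → decodePermutation-injective k c c′
                              (nxt-injective _ _ (reads-functional p q))) few
    in decodePermutation k c , λ path → ≰⇒> λ j≤K → uncurry missed (reached-complete K j≤K path)
    where
    order : Fin (k !) → Fin (suc (suc k)) → Fin (suc (suc k))
    order c = Ordered.nxt (decodePermutation k c)

-- Powers, logarithms and factorials.

n<2^n : ∀ n → n < 2 ^ n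
n<2^n zero    = s≤s z≤n
n<2^n (suc n) = begin-strict
  suc n         <⟨ s≤s (n<2^n n) ⟩
  1 + 2 ^ n     ≤⟨ +-monoˡ-≤ (2 ^ n) (m^n>0 2 n) ⟩
  2 ^ n + 2 ^ n ≡⟨ cong (2 ^ n +_) (+-identityʳ (2 ^ n)) ⟨
  2 ^ suc n ∎
  where open ≤-Reasoning

^-log₂-≤ : ∀ L n → ⌊log₂ n ⌋ ≡ L → 0 < n → 2 ^ L ≤ n
^-log₂-≤ zero    n             eq 0<n = 0<n
^-log₂-≤ (suc L) (suc zero)    eq _ with trans (sym (⌊log₂[2^n]⌋≡n 0)) eq
... | ()
^-log₂-≤ (suc L) n@(suc (suc m)) eq _ = begin
  2 * 2 ^ L           ≤⟨ *-monoʳ-≤ 2 (^-log₂-≤ L ⌊ n /2⌋ eq′ (s≤s z≤n)) ⟩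
  2 * ⌊ n /2⌋         ≡⟨ cong (⌊ n /2⌋ +_) (+-identityʳ ⌊ n /2⌋) ⟩
  ⌊ n /2⌋ + ⌊ n /2⌋   ≤⟨ +-monoʳ-≤ ⌊ n /2⌋ (⌊n/2⌋≤⌈n/2⌉ n) ⟩
  ⌊ n /2⌋ + ⌈ n /2⌉   ≡⟨ ⌊n/2⌋+⌈n/2⌉≡n n ⟩
  n ∎
  where
  open ≤-Reasoning
  eq′ : ⌊log₂ ⌊ n /2⌋ ⌋ ≡ L
  eq′ = trans (⌊log₂⌊n/2⌋⌋≡⌊log₂n⌋∸1 n) (cong (_∸ 1) eq)

!-lower : ∀ h j → h ^ j ≤ (h + j) !
!-lower h zero    = subst (λ z → 1 ≤ z !) (sym (+-identityʳ h)) (1≤n! h)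
!-lower h (suc j) = begin
  h * h ^ j             ≤⟨ *-mono-≤ (m≤n⇒m≤1+n (m≤m+n h j)) (!-lower h j) ⟩
  suc (h + j) * (h + j) ! ≡⟨ cong _! (+-suc h j) ⟨
  (h + suc j) ! ∎
  where open ≤-Reasoning

-- With h = 2 ^ ℓ ≤ n / 4, the last j ≥ n / 2 factors of k ! are at least h.
codes<! : ∀ p P Q M K ℓ k → P ≤ 2 ^ p → Q ≤ 2 ^ p → M ≤ 4 * (3 + k) →
          8 * p * K ≤ (3 + k) * (2 + ℓ) → 4 * 2 ^ ℓ ≤ 3 + k → 2 + 32 * p ≤ ℓ → 12 ≤ 3 + k →
          P ^ M * Q ^ K < k !
codes<! p P Q M K ℓ k P≤ Q≤ M≤ K≤ h≤ p≤ 12≤ = begin-strict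
  P ^ M * Q ^ K               ≤⟨ *-mono-≤ (^-monoˡ-≤ M P≤) (^-monoˡ-≤ K Q≤) ⟩
  (2 ^ p) ^ M * (2 ^ p) ^ K   ≡⟨ ^-distribˡ-+-* (2 ^ p) M K ⟨
  (2 ^ p) ^ (M + K)           ≡⟨ ^-*-assoc 2 p (M + K) ⟩
  2 ^ (p * (M + K))           <⟨ ^-monoʳ-< 2 ≤-refl exponent ⟩
  2 ^ (ℓ * j)                 ≡⟨ ^-*-assoc 2 ℓ j ⟨
  h ^ j                       ≤⟨ !-lower h j ⟩
  (h + j) !                   ≡⟨ cong _! (m+[n∸m]≡n h≤k) ⟩
  k ! ∎
  where
  open ≤-Reasoning
  N h j : ℕ
  N = 3 + k
  h = 2 ^ ℓ
  j = k ∸ h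
  6+2h≤N : 6 + 2 * h ≤ N
  6+2h≤N = *-cancelˡ-≤ 2 (begin
    2 * (6 + 2 * h) ≡⟨ eq h ⟩
    12 + 4 * h      ≤⟨ +-mono-≤ 12≤ h≤ ⟩
    N + N           ≡⟨ cong (N +_) (+-identityʳ N) ⟨
    2 * N ∎)
    where
    eq : ∀ h → 2 * (6 + 2 * h) ≡ 12 + 4 * h
    eq = solve-∀
  h≤k : h ≤ k
  h≤k = +-cancelˡ-≤ 3 h k (begin
    3 + h      ≤⟨ +-mono-≤ (m≤m+n 3 3) (m≤m+n h (h + 0)) ⟩
    6 + 2 * h  ≤⟨ 6+2h≤N ⟩
    3 + k ∎)
  N≤2j : N ≤ 2 * j
  N≤2j = +-cancelˡ-≤ N N (2 * j) (begin
    N + N               ≡⟨ cong (λ z → (3 + z) + (3 + z)) (m+[n∸m]≡n h≤k) ⟨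
    (3 + (h + j)) + (3 + (h + j)) ≡⟨ eq h j ⟩
    6 + 2 * h + 2 * j   ≤⟨ +-monoˡ-≤ (2 * j) 6+2h≤N ⟩
    N + 2 * j ∎)
    where
    eq : ∀ h j → (3 + (h + j)) + (3 + (h + j)) ≡ 6 + 2 * h + 2 * j
    eq = solve-∀
  0<ℓn : 0 < ℓ * N
  0<ℓn = *-mono-≤ (≤-trans (m≤m+n 1 (1 + 32 * p)) p≤) (s≤s (z≤n {2 + k}))
  exponent : p * (M + K) < ℓ * j
  exponent = *-cancelˡ-< 8 _ _ (begin-strict
    8 * (p * (M + K))                ≡⟨ eq₁ p M K ⟩
    8 * p * M + 8 * p * K            ≤⟨ +-mono-≤ (*-monoʳ-≤ (8 * p) M≤) K≤ ⟩
    8 * p * (4 * N) + N * (2 + ℓ)    ≡⟨ eq₂ p N ℓ ⟩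
    -- The first summand is mainly the cost of the initial labelling, with 32 p = 8 p * 4 from at
    -- most 4 N slots. For large n it is at most `N * ℓ`, which leaves the other `N * ℓ` for the
    -- flips.
    N * (2 + 32 * p) + N * ℓ         ≤⟨ +-monoˡ-≤ (N * ℓ) (*-monoʳ-≤ N p≤) ⟩
    N * ℓ + N * ℓ                    ≡⟨ eq₃ N ℓ ⟩
    2 * (ℓ * N)                      <⟨ *-monoˡ-< (ℓ * N) {{>-nonZero 0<ℓn}} {2} {4} (s≤s (s≤s (s≤s z≤n))) ⟩
    4 * (ℓ * N)                      ≤⟨ *-monoʳ-≤ 4 (*-monoʳ-≤ ℓ N≤2j) ⟩
    4 * (ℓ * (2 * j))                ≡⟨ eq₄ ℓ j ⟩
    8 * (ℓ * j) ∎)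
    where
    eq₁ : ∀ p M K → 8 * (p * (M + K)) ≡ 8 * p * M + 8 * p * K
    eq₁ = solve-∀
    eq₂ : ∀ p n ℓ → 8 * p * (4 * n) + n * (2 + ℓ) ≡ n * (2 + 32 * p) + n * ℓ
    eq₂ = solve-∀
    eq₃ : ∀ n ℓ → n * ℓ + n * ℓ ≡ 2 * (ℓ * n)
    eq₃ = solve-∀
    eq₄ : ∀ ℓ j → 4 * (ℓ * (2 * j)) ≡ 8 * (ℓ * j)
    eq₄ = solve-∀

-- Constants and the lower bound.

private
  -- By `n<2^n`, `p` bits hold a label as well as a relabelling; `suc` keeps the divisor `d`
  -- positive. The factor 8 is a product of three factors 2: the split between labels and flips, the
  -- slack for a strict inequality, and j ≥ N / 2 large factors of k !. The constant c of the
  -- theorem is 1 / d for binary logarithms.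
  p d : ℕ
  p = suc (#labels + #relabellings)
  d = 8 * p

far-apart : ∀ k → 2 ^ (4 + 32 * p) ≤ 3 + k →
  Σ (Fin (3 + k)) λ a → Σ (Fin (3 + k)) λ b → Σ (Fin (3 + k)) λ c →
  Σ (PPT (3 + k)) λ T₁ → Σ (PPT (3 + k)) λ T₂ →
  Is4PPT a b c T₁ × Is4PPT a b c T₂ ×
  ((j : ℕ) → FlipPath a b c T₁ T₂ j → (3 + k) * ⌊log₂ (3 + k) ⌋ ≤ d * j)
far-apart k 2^≤N =
  let ρ , all-far = far fuel few
  in 0F , 1F , 2F , T₁ , Ordered.orderedFan ρ , Ordered.is4PPT idₚ , Ordered.is4PPT ρ ,
     λ j path → bound j (all-far path)
  where
  open ≤-Reasoning
  open Counting k using (T₁; far; #codes)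
  N L fuel ℓ : ℕ
  N = 3 + k
  L = ⌊log₂ N ⌋
  -- The largest number of flips whose `d`-fold does not exceed `N * L`; any longer path satisfies
  -- the claim.
  fuel = N * L / d
  -- Subtracting 2 makes 2 ^ ℓ at most N / 4. It also turns the threshold 4 + 32 p for `L` into 2 +
  -- 32 p for `ℓ`.
  ℓ = L ∸ 2
  4+32p≤L : 4 + 32 * p ≤ L
  4+32p≤L = begin
    4 + 32 * p                ≡⟨ ⌊log₂[2^n]⌋≡n (4 + 32 * p) ⟨
    ⌊log₂ 2 ^ (4 + 32 * p) ⌋   ≤⟨ ⌊log₂⌋-mono-≤ 2^≤N ⟩
    L ∎
  2+ℓ≡L : 2 + ℓ ≡ L
  2+ℓ≡L = m+[n∸m]≡n (≤-trans (m≤m+n 2 (2 + 32 * p)) 4+32p≤L)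
  slots≤ : Fan.#slots {k} ≤ 4 * N
  slots≤ = begin
    Fan.#slots {k} ≤⟨ m≤m+n _ 6 ⟩
    Fan.#slots {k} + 6 ≡⟨ eq k ⟩
    4 * N ∎
    where
    eq : ∀ k → (suc (suc k) + suc (suc k)) + (suc k + suc k) + 6 ≡ 4 * (3 + k)
    eq = solve-∀
  few : #codes fuel < k !
  few = codes<! p #labels #relabellings (Fan.#slots {k}) fuel ℓ k
    (≤-trans (m≤n⇒m≤1+n (m≤m+n #labels #relabellings)) (<⇒≤ (n<2^n p)))
    (≤-trans (m≤n⇒m≤1+n (m≤n+m #relabellings #labels)) (<⇒≤ (n<2^n p)))
    slots≤
    (begin
      d * fuel    ≡⟨ *-comm d fuel ⟩
      fuel * d    ≤⟨ m/n*n≤m (N * L) d ⟩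
      N * L       ≡⟨ cong (N *_) 2+ℓ≡L ⟨
      N * (2 + ℓ) ∎)
    (begin
      4 * 2 ^ ℓ   ≡⟨ ^-distribˡ-+-* 2 2 ℓ ⟨
      2 ^ (2 + ℓ) ≡⟨ cong (2 ^_) 2+ℓ≡L ⟩
      2 ^ L       ≤⟨ ^-log₂-≤ L N refl (s≤s z≤n) ⟩
      N ∎)
    (+-cancelˡ-≤ 2 _ _ (≤-trans 4+32p≤L (≤-reflexive (sym 2+ℓ≡L))))
    (begin
      12               ≤⟨ m≤m+n 12 4 ⟩
      2 ^ 4            ≤⟨ ^-monoʳ-≤ 2 (m≤m+n 4 (32 * p)) ⟩
      2 ^ (4 + 32 * p) ≤⟨ 2^≤N ⟩
      N ∎)
  bound : ∀ j → fuel < j → N * L ≤ d * j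
  bound j fuel<j with N * L ≤? d * j
  ... | yes ≤ = ≤
  ... | no ≰ = ⊥-elim (<⇒≱ fuel<j (begin
    j             ≡⟨ m*n/n≡m j d ⟨
    (j * d) / d   ≡⟨ cong (_/ d) (*-comm j d) ⟩
    (d * j) / d   ≤⟨ /-monoˡ-≤ d (<⇒≤ (≰⇒> ≰)) ⟩
    fuel ∎))

theorem5 : Σ ℕ λ d → Σ ℕ λ N → (n : ℕ) → N ≤ n →
    Σ (Fin n) λ a → Σ (Fin n) λ b → Σ (Fin n) λ c →
    Σ (PPT n) λ T₁ → Σ (PPT n) λ T₂ →
    Is4PPT a b c T₁ × Is4PPT a b c T₂ ×
    ((k : ℕ) → FlipPath a b c T₁ T₂ k → n * ⌊log₂ n ⌋ ≤ d * k)
theorem5 = d , 2 ^ (4 + 32 * p) , λ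
  { 0                   N≤n → ⊥-elim (<⇒≱ (s≤s z≤n) (≤-trans 3≤N N≤n))
  ; 1                   N≤n → ⊥-elim (<⇒≱ (s≤s (s≤s z≤n)) (≤-trans 3≤N N≤n))
  ; 2                   N≤n → ⊥-elim (<⇒≱ (s≤s (s≤s (s≤s z≤n))) (≤-trans 3≤N N≤n))
  ; (suc (suc (suc k))) N≤n → far-apart k N≤n
  }
  where
  3≤N : 3 ≤ 2 ^ (4 + 32 * p)
  3≤N = ≤-trans (m≤m+n 3 13) (^-monoʳ-≤ 2 (m≤m+n 4 (32 * p)))
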